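{- Let $p=4m+1$ be a prime, put $n=2m$, and let $A_0=(a_0,\ldots,a_n)\in\mathbb{F}_p^{n+1}$ satisfy $a_i^2\neq a_j^2$ for all $0\le i<j\le n$. For $u,v\in\mathbb{F}_p$ define \[ D_{A_0}(u,v)=\det\left[\chi(a_i+a_j)+\chi(a_i-a_j)+u\,\chi(a_i^2+va_j^2)\right]_{0\le i,j\le n}. \] Then \[ D_{A_0}(u,v)\equiv(-1)^{m(2m+1)}u^{2m+1}v^{m(2m+1)}\left(\prod_{r=0}^{2m}\binom{2m}{r}\right)\prod_{0\le i<j\le 2m}(a_j^2-a_i^2)^2 \pmod p. \]
   Context: $\chi(t)=\left(\frac{t}{p}\right)$ is the Legendre symbol on $\mathbb{F}_p$, with $\chi(0)=0$; the determinant is an integer and the congruence is taken modulo $p$ (equivalently, as an identity in $\mathbb{F}_p$). -}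

module Defs where

open import Data.Bool.Base using (if_then_else_)
open import Data.Fin.Base using (Fin; zero; suc; toℕ; punchIn)
open import Data.Fin.Properties using (any?; _<?_)
open import Data.Integer.Base using (ℤ; +_; _+_; _-_; _*_; -_; _^_; 0ℤ; 1ℤ; -1ℤ)
open import Data.Integer.Divisibility.Signed using (_∣_; _∣?_; ∣m∣n⇒∣m+n; ∣m⇒∣-m)
open import Data.Integer.Properties using (+-0-commutativeMonoid; *-1-commutativeMonoid)
open import Data.Integer.Solver using (module +-*-Solver)
open import Data.Nat.Base using (ℕ; zero; suc)
open import Data.Product.Base using (∃; _,_)
open import Data.Vec.Functional using (Vector)
open import Function.Bundles using (_⇔_; mk⇔; Equivalence)
open import Relation.Binary.PropositionalEquality using (_≡_; refl; subst)
open import Relation.Nullary.Decidable using (Dec; does)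
open import Relation.Nullary.Decidable.Core using (yes; no)
open import Relation.Nullary.Negation using (contradiction)

import Algebra.Properties.CommutativeMonoid.Sum as Sum

open Sum +-0-commutativeMonoid public using () renaming (sum to ∑)
open Sum *-1-commutativeMonoid public using () renaming (sum to ∏)

-- The field 𝔽_p is the setoid of integers under congruence modulo p: its
-- elements are given by integer representatives, and equality of elements
-- is _≡_[mod p ].

infix 4 _≡_[mod_] _≡?_[mod_]

_≡_[mod_] : ℤ → ℤ → ℕ → Set
x ≡ y [mod p ] = + p ∣ x - y

_≡?_[mod_] : ∀ x y p → Dec (x ≡ y [mod p ])
x ≡? y [mod p ] = + p ∣? (x - y)

-- Square roots range over the complete residue system 0, …, p - 1.
IsSquare : ℕ → ℤ → Set
IsSquare p t = ∃ λ (x : Fin p) → (+ toℕ x) ^ 2 ≡ t [mod p ]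

isSquare? : ∀ p t → Dec (IsSquare p t)
isSquare? p t = any? λ x → (+ toℕ x) ^ 2 ≡? t [mod p ]

-- The Legendre symbol (t / p); the value is an integer, not a residue.
χ : ℕ → ℤ → ℤ
χ p t =
  if does (t ≡? 0ℤ [mod p ]) then 0ℤ
  else if does (isSquare? p t) then 1ℤ
  else -1ℤ

Matrix : ℕ → Set
Matrix n = Fin n → Fin n → ℤ

-- Laplace expansion along the first row.
det : ∀ {n} → Matrix n → ℤ
det {zero}  M = 1ℤ
det {suc n} M =
  ∑ λ j → -1ℤ ^ toℕ j * M zero j * det (λ i k → M (suc i) (punchIn j k))

-- The product over all pairs i < j.
∏[i<j] : ∀ {n} → (Fin n → Fin n → ℤ) → ℤ
∏[i<j] f = ∏ λ i → ∏ λ j → if does (i <? j) then f i j else 1ℤ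

D : ℕ → ∀ {n} → Vector ℤ n → ℤ → ℤ → ℤ
D p a u v = det λ i j →
  χ p (a i + a j) + χ p (a i - a j) + u * χ p (a i ^ 2 + v * a j ^ 2)

-- χ is well defined on residue classes.

≡-sym : ∀ p {x y} → x ≡ y [mod p ] → y ≡ x [mod p ]
≡-sym p {x} {y} h = subst (+ p ∣_)
  (solve 2 (λ x y → :- (x :- y) := y :- x) refl x y) (∣m⇒∣-m h)
  where open +-*-Solver

≡-trans : ∀ p {x y z} → x ≡ y [mod p ] → y ≡ z [mod p ] → x ≡ z [mod p ]
≡-trans p {x} {y} {z} h k = subst (+ p ∣_)
  (solve 3 (λ x y z → (x :- y) :+ (y :- z) := x :- z) refl x y z)
  (∣m∣n⇒∣m+n h k)
  where open +-*-Solver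

does-cong : ∀ {A B : Set} (a? : Dec A) (b? : Dec B) →
            A ⇔ B → does a? ≡ does b?
does-cong (yes _) (yes _) _ = refl
does-cong (no  _) (no  _) _ = refl
does-cong (yes a) (no ¬b) e = contradiction (Equivalence.to e a) ¬b
does-cong (no ¬a) (yes b) e = contradiction (Equivalence.from e b) ¬a

χ-cong : ∀ p {s t} → s ≡ t [mod p ] → χ p s ≡ χ p t
χ-cong p {s} {t} h
  rewrite does-cong (s ≡? 0ℤ [mod p ]) (t ≡? 0ℤ [mod p ])
            (mk⇔ (≡-trans p {t} {s} {0ℤ} (≡-sym p {s} {t} h))
                 (≡-trans p {s} {t} {0ℤ} h))
        | does-cong (isSquare? p s) (isSquare? p t)
            (mk⇔ (λ (x , e) → x , ≡-trans p {(+ toℕ x) ^ 2} {s} {t} e h)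
                 (λ (x , e) → x , ≡-trans p {(+ toℕ x) ^ 2} {t} {s} e
                                    (≡-sym p {s} {t} h)))
  = refl

-- Write h = 2m and x i = a i ^ 2.  By Euler's criterion χ t ≡ t ^ h.  Expanding
-- (a i + a j) ^ h + (a i - a j) ^ h, only even powers survive, so modulo p the
-- (i , j) entry is a polynomial in x i and x j:
--   ∑ₛ u C(h,s) v ^ s · x i ^ (h - s) · x j ^ s
--     + ∑ₖ βₖ · x i ^ (m - ⌊k/2⌋) · x j ^ ⌊k/2⌋.
-- Indexing powers of x i by h minus the exponent, the coefficient matrix is
-- lower triangular: the second sum lies strictly below the diagonal.  Hence the
-- determinant is the product of the diagonal u C(h,s) v ^ s and of two
-- Vandermonde determinants, one of them with reversed columns.
--
-- Multiplicativity of det comes from the fact that an alternating form is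
-- determined by its value at the identity.  In Euler's criterion, a nonsquare t
-- with t ^ h ≡ 1 would give, with 1², …, h², too many roots of X ^ h - 1, making
-- a Vandermonde determinant with distinct nodes vanish.
module Submission where

open import Algebra.Bundles using (Semiring)
open import Data.Bool.Base using (if_then_else_; true; false; T)
open import Data.Fin.Base using (Fin; zero; suc; toℕ; fromℕ; fromℕ<; inject₁; punchIn; _<_; _≤_)
open import Data.Fin.Properties using (_≟_; _<?_; <⇒≢; toℕ-inject₁; toℕ-fromℕ; toℕ-fromℕ<; toℕ<n)
open import Data.Fin.Relation.Unary.Top using (view; ‵fromℕ; ‵inject₁)
open import Data.Integer.Base using (ℤ; +_; _+_; _-_; _*_; -_; _^_; ∣_∣; 0ℤ; 1ℤ; -1ℤ)
open import Data.Integer.DivMod using (_%ℕ_; _/ℕ_; a≡a%ℕn+[a/ℕn]*n)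
open import Data.Integer.Divisibility.Signed using (∣m∣n⇒∣m+n; ∣m⇒∣m*n; ∣n⇒∣m*n; ∣⇒∣ᵤ; ∣ᵤ⇒∣; divides) renaming (_∣_ to _∣ℤ_)
open import Data.Integer.Properties using (+-comm; +-identityˡ; +-identityʳ; *-comm; *-assoc; *-identityˡ; *-identityʳ; *-zeroˡ; *-zeroʳ; abs-*; ⊖-≥; [+m]-[+n]≡m⊖n; ^-zeroˡ; ^-*-assoc; ^-distribˡ-+-*; +-*-semiring; +-*-commutativeSemiring; *-1-commutativeMonoid)
open import Data.Integer.Tactic.RingSolver using (solve-∀)
open import Data.Nat.Base as ℕ using (ℕ; zero; suc; z<s; s<s; s≤s; _∸_; ⌊_/2⌋; NonZero)
open import Data.Nat.Combinatorics using (_C_; nCn≡1; nC1≡n; nCk+nC[k+1]≡[n+1]C[k+1])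
open import Data.Nat.DivMod using (_%_; _/_; m≡m%n+[m/n]*n; n%n≡0)
import Data.Nat.Divisibility as ℕ
open import Data.Nat.Primality using (Prime; euclidsLemma; prime⇒nonZero; ¬prime[0]; ¬prime[1])
import Data.Nat.Properties as ℕ
import Data.Nat.Tactic.RingSolver as ℕ-Solver
open import Data.Product.Base using (_×_; _,_; proj₁; proj₂; ∃; ∃₂)
open import Data.Sum.Base as Sum using (_⊎_; inj₁; inj₂; [_,_]′)
open import Data.Unit.Base using (⊤; tt)
open import Data.Vec.Functional using (Vector; _∷_; removeAt; insertAt)
open import Function.Base using (_∘_)
open import Relation.Binary.Bundles using (Setoid)
open import Relation.Binary.PropositionalEquality using (_≡_; _≢_; _≗_; refl; sym; trans; cong; cong₂; subst; module ≡-Reasoning)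
import Relation.Binary.Reasoning.Setoid as SetoidReasoning
open import Relation.Nullary.Decidable.Core using (Dec; does; yes; no)
open import Relation.Nullary.Negation using (¬_; contradiction)
open import Defs

import Algebra.Properties.CommutativeSemiring.Binomial +-*-commutativeSemiring as Binomial
open import Algebra.Definitions.RawSemiring (Semiring.rawSemiring +-*-semiring)
  using () renaming (_^_ to _^ˢ_; _×_ to _×ˢ_)
open import Algebra.Properties.CommutativeMonoid.Sum *-1-commutativeMonoid
  using () renaming (sum-cong-≗ to ∏-cong; ∑-distrib-+ to ∏-distrib-*)
open import Algebra.Properties.Semiring.Sum +-*-semiring
  using (sum-cong-≗; ∑-distrib-+; ∑-comm; *-distribˡ-sum; *-distribʳ-sum; sum-replicate-zero; sum-init-last)


private
  variable
    k l n : ℕ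

-- Alternating multilinear forms and determinants of integer matrices.

module Determinant where

  open ≡-Reasoning

  -- The number of rows and their length are independent, so that rows can be fixed, or columns
  -- deleted, one at a time.
  Rows : ℕ → ℕ → Set
  Rows n k = Vector (Vector ℤ k) n

  infix 4 _≋_
  _≋_ : Rows n k → Rows n k → Set
  M ≋ N = ∀ i j → M i j ≡ N i j

  -- Matrices are functions, and entrywise equality does not give propositional equality; invariance
  -- of a form under it is therefore carried as a separate property.
  Congruent : (Rows n k → ℤ) → Set
  Congruent F = ∀ {M N} → M ≋ N → F M ≡ F N

  ∷-cong : ∀ (r : Vector ℤ k) {M N : Rows n k} → M ≋ N → r ∷ M ≋ r ∷ N
  ∷-cong r M≋N zero    j = refl
  ∷-cong r M≋N (suc i) j = M≋N i j

  ∷-η : (M : Rows (suc n) k) → M ≋ M zero ∷ (M ∘ suc)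
  ∷-η M zero    j = refl
  ∷-η M (suc i) j = refl

  ∷-∘ : (L : Vector ℤ k → Vector ℤ l) (r : Vector ℤ k) (N : Rows n k) →
        L ∘ (r ∷ N) ≋ L r ∷ (L ∘ N)
  ∷-∘ L r N zero    j = refl
  ∷-∘ L r N (suc i) j = refl

  tail-congruent : {F : Rows (suc n) k → ℤ} → Congruent F → ∀ r → Congruent (F ∘ (r ∷_))
  tail-congruent F-cong r M≋N = F-cong (∷-cong r M≋N)

  infixr 7 _·_⊕_
  _·_⊕_ : ℤ → Vector ℤ k → Vector ℤ k → Vector ℤ k
  (c · r ⊕ s) j = c * r j + s j

  Linear : (Vector ℤ k → ℤ) → Set
  Linear f = ∀ c r s → f (c · r ⊕ s) ≡ c * f r + f s

  -- Only the first two rows are compared. `Alternating` imposes this again after fixing any number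
  -- of leading rows, which reaches every adjacent pair.
  VanishesOnRepeat : ∀ n → (Rows (suc n) k → ℤ) → Set
  VanishesOnRepeat zero    F = ⊤
  VanishesOnRepeat (suc n) F = ∀ r N → F (r ∷ r ∷ N) ≡ 0ℤ

  -- Only a repetition of adjacent rows is required to vanish; repeat⇒0 is the
  -- general case.
  Alternating : ∀ n → (Rows n k → ℤ) → Set
  Alternating zero    F = ⊤
  Alternating (suc n) F =
    (∀ N → Linear (λ r → F (r ∷ N))) ×
    VanishesOnRepeat n F ×
    (∀ r → Alternating n (F ∘ (r ∷_)))

  alternating-resp : ∀ n {F G : Rows n k → ℤ} → F ≗ G → Alternating n F → Alternating n G
  alternating-resp zero    F≗G _ = tt
  alternating-resp (suc n) {F} {G} F≗G (lin , rep , alt) =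
    (λ N c r s → trans (sym (F≗G _)) (trans (lin N c r s)
       (cong₂ (λ x y → c * x + y) (F≗G _) (F≗G _)))) ,
    vanish n F≗G rep ,
    (λ r → alternating-resp n (F≗G ∘ (r ∷_)) (alt r))
    where
    vanish : ∀ n {F G : Rows (suc n) k → ℤ} → F ≗ G → VanishesOnRepeat n F → VanishesOnRepeat n G
    vanish zero    F≗G rep = tt
    vanish (suc n) F≗G rep r N = trans (sym (F≗G _)) (rep r N)

  record IsLinearMap (L : Vector ℤ k → Vector ℤ l) : Set where
    field
      congruent : ∀ {r s} → r ≗ s → L r ≗ L s
      linear    : ∀ c r s → L (c · r ⊕ s) ≗ c · L r ⊕ L s

  open IsLinearMap

  -- `L` acts on each row separately. It will be the deletion of a column, the insertion of a zero
  -- column, and multiplication by a fixed matrix.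
  alternating-∘ : ∀ n {F : Rows n l → ℤ} {L : Vector ℤ k → Vector ℤ l} → IsLinearMap L →
                  Congruent F → Alternating n F → Alternating n (λ N → F (L ∘ N))
  alternating-∘ zero    _  _      _ = tt
  alternating-∘ (suc n) {F} {L} L-lin F-cong (lin , rep , alt) =
    (λ N c r s → begin
      F (L ∘ ((c · r ⊕ s) ∷ N))
        ≡⟨ F-cong (λ { zero j → linear L-lin c r s j ; (suc i) j → refl }) ⟩
      F ((c · L r ⊕ L s) ∷ (L ∘ N))                   ≡⟨ lin (L ∘ N) c (L r) (L s) ⟩
      c * F (L r ∷ (L ∘ N)) + F (L s ∷ (L ∘ N))
        ≡⟨ cong₂ (λ x y → c * x + y) (F-cong (∷-∘ L r N)) (F-cong (∷-∘ L s N)) ⟨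
      c * F (L ∘ (r ∷ N)) + F (L ∘ (s ∷ N))           ∎) ,
    vanish n F-cong rep ,
    (λ r → alternating-resp n (λ N → sym (F-cong (∷-∘ L r N)))
             (alternating-∘ n L-lin (tail-congruent F-cong (L r)) (alt (L r))))
    where
    vanish : ∀ n {F : Rows (suc n) _ → ℤ} → Congruent F →
             VanishesOnRepeat n F → VanishesOnRepeat n (λ N → F (L ∘ N))
    vanish zero    F-cong rep     = tt
    vanish (suc n) F-cong rep r N = trans
      (F-cong (λ { zero j → refl ; (suc zero) j → refl ; (suc (suc i)) j → refl }))
      (rep (L r) (L ∘ N))

  ∑-zero : {f : Vector ℤ n} → (∀ i → f i ≡ 0ℤ) → ∑ f ≡ 0ℤ
  ∑-zero {n} f≡0 = trans (sum-cong-≗ f≡0) (sum-replicate-zero n)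

  ∑-linear : ∀ c (f g : Vector ℤ n) → ∑ (c · f ⊕ g) ≡ c * ∑ f + ∑ g
  ∑-linear c f g = trans (∑-distrib-+ (λ i → c * f i) g) (cong (_+ ∑ g) (sym (*-distribˡ-sum c f)))

  alternating-∑ : ∀ n (c : Vector ℤ l) {G : Fin l → Rows n k → ℤ} → (∀ i → Alternating n (G i)) →
                  Alternating n (λ N → ∑ λ i → c i * G i N)
  alternating-∑ zero    c G-alt = tt
  alternating-∑ (suc n) c {G} G-alt =
    (λ N d r s → begin
      (∑ λ i → c i * G i ((d · r ⊕ s) ∷ N))
        ≡⟨ sum-cong-≗ (λ i → trans (cong (c i *_) (proj₁ (G-alt i) N d r s)) (rearrange (c i) d _ _)) ⟩
      (∑ λ i → d * (c i * G i (r ∷ N)) + c i * G i (s ∷ N))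
        ≡⟨ ∑-linear d (λ i → c i * G i (r ∷ N)) (λ i → c i * G i (s ∷ N)) ⟩
      d * (∑ λ i → c i * G i (r ∷ N)) + (∑ λ i → c i * G i (s ∷ N)) ∎) ,
    vanish n (proj₁ ∘ proj₂ ∘ G-alt) ,
    (λ r → alternating-∑ n c (λ i → proj₂ (proj₂ (G-alt i)) r))
    where
    rearrange : ∀ a d x y → a * (d * x + y) ≡ d * (a * x) + a * y
    rearrange = solve-∀
    vanish : ∀ n {G : Fin _ → Rows (suc n) _ → ℤ} → (∀ i → VanishesOnRepeat n (G i)) →
             VanishesOnRepeat n (λ N → ∑ λ i → c i * G i N)
    vanish zero    rep     = tt
    vanish (suc n) rep r N = ∑-zero (λ i → trans (cong (c i *_) (rep i r N)) (*-zeroʳ (c i)))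

  -- Polarisation: on the repeated row `r + s` the form vanishes, and so do the two pure terms of
  -- its expansion, which leaves the sum of the two mixed terms.
  swap : (F : Rows (suc (suc n)) k → ℤ) → Alternating (suc (suc n)) F →
         ∀ r s N → F (r ∷ s ∷ N) ≡ - F (s ∷ r ∷ N)
  swap F (lin , rep , alt) r s N = begin
    x                       ≡⟨ expand x y ⟩
    e - y                   ≡⟨ cong (_- y) e≡0 ⟩
    0ℤ - y                  ≡⟨ +-identityˡ (- y) ⟩
    - y                     ∎
    where
    t = 1ℤ · r ⊕ s
    x = F (r ∷ s ∷ N)
    y = F (s ∷ r ∷ N)
    e = 1ℤ * (1ℤ * 0ℤ + x) + (1ℤ * y + 0ℤ)
    expand : ∀ x y → x ≡ (1ℤ * (1ℤ * 0ℤ + x) + (1ℤ * y + 0ℤ)) - y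
    expand = solve-∀
    e≡0 : e ≡ 0ℤ
    e≡0 = begin
      1ℤ * (1ℤ * 0ℤ + x) + (1ℤ * y + 0ℤ)
        ≡⟨ cong₂ (λ a b → 1ℤ * (1ℤ * a + x) + (1ℤ * y + b)) (rep r N) (rep s N) ⟨
      1ℤ * (1ℤ * F (r ∷ r ∷ N) + x) + (1ℤ * y + F (s ∷ s ∷ N))
        ≡⟨ cong₂ (λ a b → 1ℤ * a + b) (proj₁ (alt r) N 1ℤ r s) (proj₁ (alt s) N 1ℤ r s) ⟨
      1ℤ * F (r ∷ t ∷ N) + F (s ∷ t ∷ N)
        ≡⟨ lin (t ∷ N) 1ℤ r s ⟨
      F (t ∷ t ∷ N)
        ≡⟨ rep t N ⟩
      0ℤ ∎

  -- Swapping `r` past the first row of `N` reduces to the form on the remaining rows, until the two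
  -- equal rows are adjacent.
  repeat⇒0 : ∀ n {F : Rows (suc n) k → ℤ} → Congruent F → Alternating (suc n) F →
             ∀ r N i → N i ≗ r → F (r ∷ N) ≡ 0ℤ
  repeat⇒0 (suc n) F-cong (_ , rep , _) r N zero Ni≗r = trans
    (F-cong λ { zero j → refl ; (suc zero) j → Ni≗r j ; (suc (suc i)) j → refl })
    (rep r (N ∘ suc))
  repeat⇒0 (suc n) {F} F-cong F-alt@(_ , _ , alt) r N (suc i) Ni≗r = begin
    F (r ∷ N)                          ≡⟨ F-cong (∷-cong r (∷-η N)) ⟩
    F (r ∷ N zero ∷ (N ∘ suc))         ≡⟨ swap F F-alt r (N zero) (N ∘ suc) ⟩
    - F (N zero ∷ r ∷ (N ∘ suc))
      ≡⟨ cong -_ (repeat⇒0 n (tail-congruent F-cong (N zero)) (alt (N zero)) r (N ∘ suc) i Ni≗r) ⟩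
    - 0ℤ                               ∎

  -- Row `j` reaches the top by `toℕ j` adjacent swaps, each costing one sign.
  move-to-head : ∀ n {F : Rows (suc n) k → ℤ} → Congruent F → Alternating (suc n) F →
                 ∀ w j → F (w j ∷ removeAt w j) ≡ -1ℤ ^ toℕ j * F w
  move-to-head n       {F} F-cong F-alt w zero =
    trans (F-cong λ { zero j → refl ; (suc i) j → refl }) (sym (*-identityˡ (F w)))
  move-to-head (suc n) {F} F-cong F-alt@(_ , _ , alt) w (suc j) = begin
    F (w (suc j) ∷ removeAt w (suc j))
      ≡⟨ F-cong (∷-cong (w (suc j)) λ { zero _ → refl ; (suc i) _ → refl }) ⟩
    F (w (suc j) ∷ w zero ∷ removeAt (w ∘ suc) j)
      ≡⟨ swap F F-alt (w (suc j)) (w zero) _ ⟩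
    - F (w zero ∷ w (suc j) ∷ removeAt (w ∘ suc) j)
      ≡⟨ cong -_ (move-to-head n (tail-congruent F-cong (w zero)) (alt (w zero)) (w ∘ suc) j) ⟩
    - (-1ℤ ^ toℕ j * F (w zero ∷ (w ∘ suc)))
      ≡⟨ cong (λ x → - (-1ℤ ^ toℕ j * x)) (F-cong (∷-η w)) ⟨
    - (-1ℤ ^ toℕ j * F w)
      ≡⟨ negate (-1ℤ ^ toℕ j) (F w) ⟩
    -1ℤ * -1ℤ ^ toℕ j * F w ∎
    where
    negate : ∀ x y → - (x * y) ≡ -1ℤ * x * y
    negate = solve-∀

  -- Typically `e` is a row already fixed in front of `N`, which is what the vanishing hypothesis
  -- abstracts. Linearity then discards the multiples of `e` row by row.
  add-multiples : ∀ n {F : Rows n k → ℤ} → Congruent F → Alternating n F →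
                  (e : Vector ℤ k) → (∀ N i → N i ≗ e → F N ≡ 0ℤ) →
                  ∀ (c : Vector ℤ n) N → F (λ i → c i · e ⊕ N i) ≡ F N
  add-multiples zero    F-cong _ e F-e c N = F-cong λ ()
  add-multiples (suc n) {F} F-cong (lin , rep , alt) e F-e c N = begin
    F (λ i → c i · e ⊕ N i)                            ≡⟨ F-cong (∷-η _) ⟩
    F ((c zero · e ⊕ N zero) ∷ N′)                     ≡⟨ lin N′ (c zero) e (N zero) ⟩
    c zero * F (e ∷ N′) + F (N zero ∷ N′)
      ≡⟨ cong (λ x → c zero * x + F (N zero ∷ N′)) (F-e (e ∷ N′) zero (λ _ → refl)) ⟩
    c zero * 0ℤ + F (N zero ∷ N′)                      ≡⟨ cong (_+ F (N zero ∷ N′)) (*-zeroʳ (c zero)) ⟩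
    0ℤ + F (N zero ∷ N′)                               ≡⟨ +-identityˡ _ ⟩
    F (N zero ∷ N′)
      ≡⟨ add-multiples n (tail-congruent F-cong (N zero)) (alt (N zero)) e
           (λ M i → F-e (N zero ∷ M) (suc i)) (c ∘ suc) (N ∘ suc) ⟩
    F (N zero ∷ (N ∘ suc))                             ≡⟨ F-cong (∷-η N) ⟨
    F N                                                ∎
    where
    N′ : Rows n _
    N′ i = c (suc i) · e ⊕ N (suc i)

  -- The identity matrix and expansion in the standard basis.

  𝟙 : Matrix n
  𝟙 zero    zero    = 1ℤ
  𝟙 zero    (suc j) = 0ℤ
  𝟙 (suc i) zero    = 0ℤ
  𝟙 (suc i) (suc j) = 𝟙 i j

  𝟙-comm : ∀ (i j : Fin n) → 𝟙 i j ≡ 𝟙 j i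
  𝟙-comm zero    zero    = refl
  𝟙-comm zero    (suc j) = refl
  𝟙-comm (suc i) zero    = refl
  𝟙-comm (suc i) (suc j) = 𝟙-comm i j

  ∑-𝟙 : ∀ (i : Fin n) (f : Vector ℤ n) → ∑ (λ j → 𝟙 i j * f j) ≡ f i
  ∑-𝟙 zero    f = trans
    (cong₂ _+_ (*-identityˡ (f zero)) (∑-zero {f = λ j → 0ℤ * f (suc j)} λ j → *-zeroˡ (f (suc j))))
    (+-identityʳ (f zero))
  ∑-𝟙 (suc i) f = trans (cong₂ _+_ (*-zeroˡ (f zero)) (∑-𝟙 i (f ∘ suc))) (+-identityˡ (f (suc i)))

  linear-∑ : {f : Vector ℤ k → ℤ} → Linear f → ∀ (c : Vector ℤ l) (v : Rows l k) →
             f (λ j → ∑ λ i → c i * v i j) ≡ ∑ λ i → c i * f (v i)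
  linear-∑ {l = zero}  {f = f} lin c v = begin
    -- The zero vector is `-1ℤ · 0 ⊕ 0` by computation, so linearity forces its value to be 0.
    f (λ _ → 0ℤ)                               ≡⟨ lin -1ℤ (λ _ → 0ℤ) (λ _ → 0ℤ) ⟩
    -1ℤ * f (λ _ → 0ℤ) + f (λ _ → 0ℤ)          ≡⟨ cancel (f (λ _ → 0ℤ)) ⟩
    0ℤ                                         ∎
    where
    cancel : ∀ x → -1ℤ * x + x ≡ 0ℤ
    cancel = solve-∀
  linear-∑ {l = suc l} {f = f} lin c v = trans (lin (c zero) (v zero) _)
    (cong (λ x → c zero * f (v zero) + x) (linear-∑ {f = f} lin (c ∘ suc) (v ∘ suc)))

  -- Splits off the multiple of `𝟙 j` that `add-multiples` can discard, leaving a row with entry `j`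
  -- cleared.
  insert-remove : ∀ (r : Vector ℤ (suc k)) j → r ≗ r j · 𝟙 j ⊕ insertAt (removeAt r j) j 0ℤ
  insert-remove r zero zero    = unit (r zero)
    where
    unit : ∀ x → x ≡ x * 1ℤ + 0ℤ
    unit = solve-∀
  insert-remove r zero (suc i) = drop-zero (r zero) (r (suc i))
    where
    drop-zero : ∀ x y → y ≡ x * 0ℤ + y
    drop-zero = solve-∀
  insert-remove {suc k} r (suc j) zero    = drop-zero (r (suc j)) (r zero)
    where
    drop-zero : ∀ x y → y ≡ x * 0ℤ + y
    drop-zero = solve-∀
  insert-remove {suc k} r (suc j) (suc i) = insert-remove (r ∘ suc) j i

  insert-cong : ∀ j {r s : Vector ℤ k} → r ≗ s → insertAt r j 0ℤ ≗ insertAt s j 0ℤ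
  insert-cong zero    r≗s zero    = refl
  insert-cong zero    r≗s (suc i) = r≗s i
  insert-cong {suc k} (suc j) r≗s zero    = r≗s zero
  insert-cong {suc k} (suc j) r≗s (suc i) = insert-cong j (r≗s ∘ suc) i

  -- A zero column inserted into the identity gives all rows but row `j` of the larger identity.
  -- With `𝟙 j` placed on top, the result is an identity whose row `j` was moved to the head.
  insert-𝟙 : ∀ j (i : Fin n) → insertAt (𝟙 i) j 0ℤ ≗ 𝟙 (punchIn j i)
  insert-𝟙 zero    i       zero    = refl
  insert-𝟙 zero    i       (suc l) = refl
  insert-𝟙 (suc j) zero    zero    = refl
  insert-𝟙 (suc j) (suc i) zero    = refl
  insert-𝟙 (suc j) (suc i) (suc l) = insert-𝟙 j i l
  insert-𝟙 (suc j) zero    (suc l) = zeros j l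
    where
    zeros : ∀ {k} (j : Fin (suc k)) → insertAt (λ _ → 0ℤ) j 0ℤ ≗ λ _ → 0ℤ
    zeros zero    zero    = refl
    zeros zero    (suc l) = refl
    zeros {suc k} (suc j) zero    = refl
    zeros {suc k} (suc j) (suc l) = zeros j l

  insert-linear : ∀ j → IsLinearMap {k} (λ r → insertAt r j 0ℤ)
  congruent (insert-linear j) = insert-cong j
  linear    (insert-linear zero) c r s zero    = zeros c
    where
    zeros : ∀ c → 0ℤ ≡ c * 0ℤ + 0ℤ
    zeros = solve-∀
  linear    (insert-linear zero) c r s (suc i) = refl
  linear    (insert-linear {suc k} (suc j)) c r s zero    = refl
  linear    (insert-linear {suc k} (suc j)) c r s (suc i) = linear (insert-linear j) c (r ∘ suc) (s ∘ suc) i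

  -- An alternating form is determined by its value at 𝟙: expand
  -- the first row in the standard basis, clear column j of the other rows
  -- by subtracting multiples of the basis vector 𝟙 j, and induct.
  alternating-unique : ∀ n {F : Rows n n → ℤ} → Congruent F → Alternating n F →
                       ∀ M → F M ≡ det M * F 𝟙
  alternating-unique zero    {F} F-cong _ M = trans (F-cong λ ()) (sym (*-identityˡ (F 𝟙)))
  alternating-unique (suc n) {F} F-cong F-alt@(lin , _ , alt) M = begin
    F M
      ≡⟨ F-cong M≋ ⟩
    F ((λ l → ∑ λ j → M zero j * 𝟙 j l) ∷ N)
      ≡⟨ linear-∑ {f = λ r → F (r ∷ N)} (lin N) (M zero) 𝟙 ⟩
    (∑ λ j → M zero j * F (𝟙 j ∷ N))
      ≡⟨ sum-cong-≗ (λ j → trans (cong (M zero j *_) (minor j)) (rearrange (M zero j) (det λ i → removeAt (N i) j) (-1ℤ ^ toℕ j) (F 𝟙))) ⟩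
    (∑ λ j → -1ℤ ^ toℕ j * M zero j * det (λ i → removeAt (N i) j) * F 𝟙)
      ≡⟨ *-distribʳ-sum (F 𝟙) (λ j → -1ℤ ^ toℕ j * M zero j * det (λ i → removeAt (N i) j)) ⟨
    det M * F 𝟙 ∎
    where
    N = M ∘ suc
    rearrange : ∀ a d s f → a * (d * (s * f)) ≡ s * a * d * f
    rearrange = solve-∀
    M≋ : M ≋ (λ l → ∑ λ j → M zero j * 𝟙 j l) ∷ N
    M≋ zero    l = begin
      M zero l                      ≡⟨ ∑-𝟙 l (M zero) ⟨
      (∑ λ j → 𝟙 l j * M zero j)
        ≡⟨ sum-cong-≗ (λ j → trans (cong (_* M zero j) (𝟙-comm l j)) (*-comm (𝟙 j l) (M zero j))) ⟩
      (∑ λ j → M zero j * 𝟙 j l)    ∎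
    M≋ (suc i) l = refl
    minor : ∀ j → F (𝟙 j ∷ N) ≡ det (λ i → removeAt (N i) j) * (-1ℤ ^ toℕ j * F 𝟙)
    minor j = begin
      F (𝟙 j ∷ N)
        ≡⟨ F-cong (∷-cong (𝟙 j) λ i → insert-remove (N i) j) ⟩
      F (𝟙 j ∷ λ i → N i j · 𝟙 j ⊕ insertAt (removeAt (N i) j) j 0ℤ)
        ≡⟨ add-multiples n (tail-congruent F-cong (𝟙 j)) (alt (𝟙 j)) (𝟙 j)
             (λ N′ → repeat⇒0 n F-cong F-alt (𝟙 j) N′) (λ i → N i j) _ ⟩
      F (𝟙 j ∷ λ i → insertAt (removeAt (N i) j) j 0ℤ)
        ≡⟨ alternating-unique n {λ N′ → F (𝟙 j ∷ λ i → insertAt (N′ i) j 0ℤ)}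
             (λ M≋N → F-cong (∷-cong (𝟙 j) λ i → insert-cong j (M≋N i)))
             (alternating-∘ n (insert-linear j) (tail-congruent F-cong (𝟙 j)) (alt (𝟙 j)))
             (λ i → removeAt (N i) j) ⟩
      det (λ i → removeAt (N i) j) * F (𝟙 j ∷ λ i → insertAt (𝟙 i) j 0ℤ)
        ≡⟨ cong (det (λ i → removeAt (N i) j) *_)
             (trans (F-cong (∷-cong (𝟙 j) λ i → insert-𝟙 j i)) (move-to-head n F-cong F-alt 𝟙 j)) ⟩
      det (λ i → removeAt (N i) j) * (-1ℤ ^ toℕ j * F 𝟙) ∎

  -- Alternation and multiplicativity of the Laplace determinant.

  det-cong : Congruent (det {n})
  det-cong {zero}  M≋N = refl
  det-cong {suc n} M≋N = sum-cong-≗ λ j →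
    cong₂ (λ x y → -1ℤ ^ toℕ j * x * y) (M≋N zero j) (det-cong λ i l → M≋N (suc i) (punchIn j l))

  -- The terms of an iterated Laplace expansion indexed by the chosen
  -- columns j and punchIn j k, paired off with the columns exchanged.
  Antisymmetric : ∀ n → (Fin (suc n) → Fin n → ℤ) → Set
  Antisymmetric zero    f = ⊤
  Antisymmetric (suc n) f =
    (∀ k → f zero k + f (suc k) zero ≡ 0ℤ) × Antisymmetric n (λ j k → f (suc j) (suc k))

  -- The terms in which one chosen column is column 0 cancel in pairs; the others form the same kind
  -- of double sum with one column fewer.
  ∑∑-antisymmetric : ∀ n f → Antisymmetric n f → (∑ λ j → ∑ λ k → f j k) ≡ 0ℤ
  ∑∑-antisymmetric zero    f _ = refl
  ∑∑-antisymmetric (suc n) f (cancel , anti) = begin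
    A + (∑ λ j → f (suc j) zero + ∑ λ k → f (suc j) (suc k))
      ≡⟨ cong (λ x → A + x) (∑-distrib-+ (λ j → f (suc j) zero) (λ j → ∑ λ k → f (suc j) (suc k))) ⟩
    A + (B + (∑ λ j → ∑ λ k → f (suc j) (suc k)))
      ≡⟨ cong (λ x → A + (B + x)) (∑∑-antisymmetric n _ anti) ⟩
    A + (B + 0ℤ)
      ≡⟨ cong (λ x → A + x) (+-identityʳ B) ⟩
    A + B
      ≡⟨ ∑-distrib-+ (f zero) (λ k → f (suc k) zero) ⟨
    (∑ λ k → f zero k + f (suc k) zero)
      ≡⟨ ∑-zero cancel ⟩
    0ℤ ∎
    where
    A = ∑ (f zero)
    B = ∑ λ j → f (suc j) zero

  -- Here `h` is the remaining minor as a function of its selection of columns. Choosing two columns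
  -- in either order leaves the same selection, but the larger one has its index lowered by one when
  -- it is chosen second, so the signs are opposite.
  laplace-antisymmetric : ∀ n (r : Vector ℤ (suc (suc n))) (h : (Fin n → Fin (suc (suc n))) → ℤ) →
    (∀ φ ψ → φ ≗ ψ → h φ ≡ h ψ) →
    Antisymmetric (suc n) λ j k →
      -1ℤ ^ toℕ j * r j * (-1ℤ ^ toℕ k * r (punchIn j k) * h (punchIn j ∘ punchIn k))
  laplace-antisymmetric n r h h-cong =
    (λ k → cancel (-1ℤ ^ toℕ k) (r zero) (r (suc k)) (h (suc ∘ punchIn k))) , rest n r h h-cong
    where
    cancel : ∀ s x y d → 1ℤ * x * (s * y * d) + -1ℤ * s * y * (1ℤ * x * d) ≡ 0ℤ
    cancel = solve-∀
    -- When neither chosen column is column 0, the remaining selection keeps column 0 and is the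
    -- lift of a selection among the later columns.
    lift : ∀ {n} → (Fin n → Fin (suc (suc n))) → Fin (suc n) → Fin (suc (suc (suc n)))
    lift φ zero    = zero
    lift φ (suc i) = suc (φ i)
    antisymmetric-resp : ∀ n {f g : Fin (suc n) → Fin n → ℤ} → (∀ j k → f j k ≡ g j k) →
                         Antisymmetric n f → Antisymmetric n g
    antisymmetric-resp zero    f≗g _ = tt
    antisymmetric-resp (suc n) f≗g (c , a) =
      (λ k → trans (sym (cong₂ _+_ (f≗g zero k) (f≗g (suc k) zero))) (c k)) ,
      antisymmetric-resp n (λ j k → f≗g (suc j) (suc k)) a
    rest : ∀ n (r : Vector ℤ (suc (suc n))) (h : (Fin n → Fin (suc (suc n))) → ℤ) →
      (∀ φ ψ → φ ≗ ψ → h φ ≡ h ψ) → Antisymmetric n λ j k →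
      -1ℤ * -1ℤ ^ toℕ j * r (suc j) * (-1ℤ * -1ℤ ^ toℕ k * r (suc (punchIn j k)) * h (punchIn (suc j) ∘ punchIn (suc k)))
    rest zero    r h h-cong = tt
    rest (suc n) r h h-cong = antisymmetric-resp (suc n)
      (λ j k → trans
        (cong (λ x → -1ℤ ^ toℕ j * r (suc j) * (-1ℤ ^ toℕ k * r (suc (punchIn j k)) * x))
          (h-cong (lift (punchIn j ∘ punchIn k)) (punchIn (suc j) ∘ punchIn (suc k))
            λ { zero → refl ; (suc i) → refl }))
        (signs (-1ℤ ^ toℕ j) (r (suc j)) (-1ℤ ^ toℕ k) (r (suc (punchIn j k))) (h (punchIn (suc j) ∘ punchIn (suc k)))))
      (laplace-antisymmetric n (r ∘ suc) (h ∘ lift)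
        (λ φ ψ φ≗ψ → h-cong (lift φ) (lift ψ) λ { zero → refl ; (suc i) → cong suc (φ≗ψ i) }))
      where
      signs : ∀ s x t y d → s * x * (t * y * d) ≡ -1ℤ * s * x * (-1ℤ * t * y * d)
      signs = solve-∀

  det-alternating : ∀ n → Alternating n (det {n})
  det-alternating zero    = tt
  det-alternating (suc n) = lin , vanish n , alt
    where
    lin : ∀ N → Linear (λ r → det (r ∷ N))
    lin N c r s = trans
      (sum-cong-≗ λ j → rearrange (-1ℤ ^ toℕ j) c (r j) (s j) (det λ i → removeAt (N i) j))
      (∑-linear c (λ j → -1ℤ ^ toℕ j * r j * det (λ i → removeAt (N i) j))
                  (λ j → -1ℤ ^ toℕ j * s j * det (λ i → removeAt (N i) j)))
      where
      rearrange : ∀ σ c x y d → σ * (c * x + y) * d ≡ c * (σ * x * d) + σ * y * d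
      rearrange = solve-∀
    vanish : ∀ n → VanishesOnRepeat n (det {suc n})
    vanish zero    = tt
    vanish (suc n) r N = trans
      (sum-cong-≗ λ j → *-distribˡ-sum (-1ℤ ^ toℕ j * r j) λ k →
        -1ℤ ^ toℕ k * r (punchIn j k) * det (λ i → N i ∘ punchIn j ∘ punchIn k))
      (∑∑-antisymmetric (suc n)
        (λ j k → -1ℤ ^ toℕ j * r j * (-1ℤ ^ toℕ k * r (punchIn j k) * det (λ i → N i ∘ punchIn j ∘ punchIn k)))
        (laplace-antisymmetric n r (λ φ → det (λ i → N i ∘ φ))
          (λ φ ψ φ≗ψ → det-cong λ i l → cong (N i) (φ≗ψ l))))
    alt : ∀ r → Alternating n (λ N → det (r ∷ N))
    alt r = alternating-∑ n (λ j → -1ℤ ^ toℕ j * r j) λ j →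
      alternating-∘ n {L = λ s → removeAt s j}
        (record { congruent = λ r≗s i → r≗s (punchIn j i) ; linear = λ c r s i → refl })
        det-cong (det-alternating n)

  -- As a function of the rows of `A`, the determinant of the product is alternating, and at the
  -- identity its value is `det B`.
  det-* : (A B : Matrix n) → det (λ i j → ∑ λ k → A i k * B k j) ≡ det A * det B
  det-* {n} A B = trans
    (alternating-unique n {λ M → det (λ i → rowTimes (M i))}
      (λ M≋N → det-cong λ i → congruent rowTimes-linear (M≋N i))
      (alternating-∘ n rowTimes-linear det-cong (det-alternating n)) A)
    (cong (det A *_) (det-cong λ i j → ∑-𝟙 i (λ k → B k j)))
    where
    rowTimes : Vector ℤ n → Vector ℤ n
    rowTimes r j = ∑ λ k → r k * B k j
    rowTimes-linear : IsLinearMap rowTimes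
    congruent rowTimes-linear r≗s j = sum-cong-≗ λ k → cong (_* B k j) (r≗s k)
    linear    rowTimes-linear c r s j = trans
      (sum-cong-≗ λ k → rearrange c (r k) (s k) (B k j))
      (∑-linear c (λ k → r k * B k j) (λ k → s k * B k j))
      where
      rearrange : ∀ c x y b → (c * x + y) * b ≡ c * (x * b) + y * b
      rearrange = solve-∀

  -- Triangular and diagonal matrices, zero columns, and scaling.

  det-lowerTriangular : (A : Matrix n) → (∀ i j → i < j → A i j ≡ 0ℤ) → det A ≡ ∏ λ i → A i i
  det-lowerTriangular {zero}  A low = refl
  det-lowerTriangular {suc n} A low = begin
    1ℤ * A zero zero * det A′ + (∑ λ j → -1ℤ * -1ℤ ^ toℕ j * A zero (suc j) * minor j)
      ≡⟨ cong₂ (λ x y → 1ℤ * A zero zero * x + y)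
           (det-lowerTriangular A′ (λ i j i<j → low (suc i) (suc j) (s<s i<j)))
           (∑-zero λ j → trans (cong (λ x → -1ℤ * -1ℤ ^ toℕ j * x * minor j) (low zero (suc j) z<s))
                               (zeros (-1ℤ * -1ℤ ^ toℕ j) (minor j))) ⟩
    1ℤ * A zero zero * (∏ λ i → A (suc i) (suc i)) + 0ℤ
      ≡⟨ simplify (A zero zero) _ ⟩
    A zero zero * (∏ λ i → A (suc i) (suc i)) ∎
    where
    A′ : Matrix n
    A′ i j = A (suc i) (suc j)
    minor : Fin n → ℤ
    minor j = det λ i k → A (suc i) (punchIn (suc j) k)
    zeros : ∀ s d → s * 0ℤ * d ≡ 0ℤ
    zeros = solve-∀
    simplify : ∀ x y → 1ℤ * x * y + 0ℤ ≡ x * y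
    simplify = solve-∀

  𝟙-diagonal : ∀ (i : Fin n) → 𝟙 i i ≡ 1ℤ
  𝟙-diagonal zero    = refl
  𝟙-diagonal (suc i) = 𝟙-diagonal i

  𝟙-off-diagonal : ∀ {i j : Fin n} → i ≢ j → 𝟙 i j ≡ 0ℤ
  𝟙-off-diagonal {i = zero}  {zero}  i≢j = contradiction refl i≢j
  𝟙-off-diagonal {i = zero}  {suc j} i≢j = refl
  𝟙-off-diagonal {i = suc i} {zero}  i≢j = refl
  𝟙-off-diagonal {i = suc i} {suc j} i≢j = 𝟙-off-diagonal (i≢j ∘ cong suc)

  -- The first Laplace term has a factor from the zero column; in every other term the minor still
  -- contains that column, and induction applies.
  det-zeroColumn : (M : Matrix (suc n)) → (∀ i → M i zero ≡ 0ℤ) → det M ≡ 0ℤ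
  det-zeroColumn {n} M M≡0 = ∑-zero {f = λ j → -1ℤ ^ toℕ j * M zero j * minor j} λ
    { zero    → trans (cong (λ x → 1ℤ * x * minor zero) (M≡0 zero)) (zeros 1ℤ (minor zero))
    ; (suc j) → trans (cong (-1ℤ ^ toℕ (suc j) * M zero (suc j) *_) (minor≡0 M M≡0 j))
                      (*-zeroʳ (-1ℤ ^ toℕ (suc j) * M zero (suc j)))
    }
    where
    minor : Fin (suc n) → ℤ
    minor j = det λ i k → M (suc i) (punchIn j k)
    zeros : ∀ s d → s * 0ℤ * d ≡ 0ℤ
    zeros = solve-∀
    minor≡0 : ∀ {n} (M : Matrix (suc n)) → (∀ i → M i zero ≡ 0ℤ) →
              (j : Fin n) → det (λ i k → M (suc i) (punchIn (suc j) k)) ≡ 0ℤ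
    minor≡0 {suc n} M M≡0 j = det-zeroColumn (λ i k → M (suc i) (punchIn (suc j) k)) (M≡0 ∘ suc)

  diagonal : Vector ℤ n → Matrix n
  diagonal c i j = 𝟙 i j * c j

  det-diagonal : (c : Vector ℤ n) → det (diagonal c) ≡ ∏ c
  det-diagonal c = trans
    (det-lowerTriangular (diagonal c) λ i j i<j →
      trans (cong (_* c j) (𝟙-off-diagonal (<⇒≢ i<j))) (*-zeroˡ (c j)))
    (∏-cong λ i → trans (cong (_* c i) (𝟙-diagonal i)) (*-identityˡ (c i)))

  det-scaleColumns : ∀ (M : Matrix n) c → det (λ i j → M i j * c j) ≡ det M * ∏ c
  det-scaleColumns M c = begin
    det (λ i j → M i j * c j)
      ≡⟨ det-cong (λ i j → trans (cong (_* c j) (sym (∑-𝟙 j (M i)))) (*-distribʳ-sum (c j) (λ k → 𝟙 j k * M i k))) ⟩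
    det (λ i j → ∑ λ k → 𝟙 j k * M i k * c j)
      ≡⟨ det-cong (λ i j → sum-cong-≗ λ k → trans (cong (λ x → x * M i k * c j) (𝟙-comm j k)) (rearrange (𝟙 k j) (M i k) (c j))) ⟩
    det (λ i j → ∑ λ k → M i k * diagonal c k j)
      ≡⟨ det-* M (diagonal c) ⟩
    det M * det (diagonal c)
      ≡⟨ cong (det M *_) (det-diagonal c) ⟩
    det M * ∏ c ∎
    where
    rearrange : ∀ e x y → e * x * y ≡ x * (e * y)
    rearrange = solve-∀

  det-scaleRows : ∀ (M : Matrix n) c → det (λ i j → c i * M i j) ≡ ∏ c * det M
  det-scaleRows M c = begin
    det (λ i j → c i * M i j)
      ≡⟨ det-cong (λ i j → sym (∑-𝟙 i (λ k → c k * M k j))) ⟩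
    det (λ i j → ∑ λ k → 𝟙 i k * (c k * M k j))
      ≡⟨ det-cong (λ i j → sum-cong-≗ λ k → sym (*-assoc (𝟙 i k) (c k) (M k j))) ⟩
    det (λ i j → ∑ λ k → diagonal c i k * M k j)
      ≡⟨ det-* (diagonal c) M ⟩
    det (diagonal c) * det M
      ≡⟨ cong (_* det M) (det-diagonal c) ⟩
    ∏ c * det M ∎

  -- Vandermonde determinants.

  -- Proceeding from the top, the row directly above has already been restored to its original form,
  -- so the extra term repeats two adjacent rows.
  subtract-previous : ∀ n {F : Rows (suc n) k → ℤ} → Congruent F → Alternating (suc n) F →
    ∀ (c : Vector ℤ n) N → F (N zero ∷ λ i → c i · N (inject₁ i) ⊕ N (suc i)) ≡ F N
  subtract-previous zero    F-cong _ c N = F-cong λ { zero j → refl }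
  subtract-previous {k} (suc n) {F} F-cong (_ , rep , alt) c N = begin
    F (N zero ∷ λ i → c i · N (inject₁ i) ⊕ N (suc i))
      ≡⟨ F-cong (∷-cong (N zero) (∷-η _)) ⟩
    F (N zero ∷ (c zero · N zero ⊕ N (suc zero)) ∷ S)
      ≡⟨ proj₁ (alt (N zero)) S (c zero) (N zero) (N (suc zero)) ⟩
    c zero * F (N zero ∷ N zero ∷ S) + F (N zero ∷ N (suc zero) ∷ S)
      ≡⟨ cong (λ x → c zero * x + F (N zero ∷ N (suc zero) ∷ S)) (rep (N zero) S) ⟩
    c zero * 0ℤ + F (N zero ∷ N (suc zero) ∷ S)
      ≡⟨ simplify (c zero) (F (N zero ∷ N (suc zero) ∷ S)) ⟩
    F (N zero ∷ N (suc zero) ∷ S)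
      ≡⟨ subtract-previous n (tail-congruent F-cong (N zero)) (alt (N zero)) (c ∘ suc) (N ∘ suc) ⟩
    F (N zero ∷ (N ∘ suc))
      ≡⟨ F-cong (∷-η N) ⟨
    F N ∎
    where
    S : Rows n k
    S i = c (suc i) · N (suc (inject₁ i)) ⊕ N (suc (suc i))
    simplify : ∀ c x → c * 0ℤ + x ≡ x
    simplify = solve-∀

  ∏[i<j]-suc : (f : Fin (suc n) → Fin (suc n) → ℤ) →
               ∏[i<j] f ≡ (∏ λ j → f zero (suc j)) * ∏[i<j] (λ i j → f (suc i) (suc j))
  ∏[i<j]-suc f = cong₂ _*_ (*-identityˡ (∏ λ j → f zero (suc j)))
    (∏-cong λ i → *-identityˡ (∏ λ j → if does (i <? j) then f (suc i) (suc j) else 1ℤ))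

  -- Subtracting `x zero` times each row from the next clears column 0 below its top entry. In each
  -- other column a factor `x j - x zero` comes out, leaving the Vandermonde matrix of the remaining
  -- nodes.
  det-vandermonde : (x : Vector ℤ n) →
                    det (λ s j → x j ^ toℕ s) ≡ ∏[i<j] (λ i j → x j - x i)
  det-vandermonde {zero}  x = refl
  det-vandermonde {suc n} x = begin
    det Z
      ≡⟨ subtract-previous n det-cong (det-alternating (suc n)) (λ _ → - x₀) Z ⟨
    det (Z zero ∷ λ s → - x₀ · Z (inject₁ s) ⊕ Z (suc s))
      ≡⟨⟩
    1ℤ * 1ℤ * det (λ s j → R s (suc j)) + (∑ λ j → -1ℤ ^ toℕ (suc j) * 1ℤ * det (λ s k → R s (punchIn (suc j) k)))
      ≡⟨ cong₂ (λ a b → 1ℤ * 1ℤ * a + b)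
           (trans (det-cong λ s j → R-entry s (suc j)) (det-scaleColumns _ (λ j → x (suc j) - x₀)))
           (∑-zero λ j → trans (cong (-1ℤ ^ toℕ (suc j) * 1ℤ *_) (minor≡0 R R-zero j)) (*-zeroʳ (-1ℤ ^ toℕ (suc j) * 1ℤ))) ⟩
    1ℤ * 1ℤ * (det (λ s j → x (suc j) ^ toℕ s) * ∏ (λ j → x (suc j) - x₀)) + 0ℤ
      ≡⟨ simplify (det λ s j → x (suc j) ^ toℕ s) (∏ λ j → x (suc j) - x₀) ⟩
    ∏ (λ j → x (suc j) - x₀) * det (λ s j → x (suc j) ^ toℕ s)
      ≡⟨ cong (∏ (λ j → x (suc j) - x₀) *_) (det-vandermonde (x ∘ suc)) ⟩
    ∏ (λ j → x (suc j) - x₀) * ∏[i<j] (λ i j → x (suc j) - x (suc i))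
      ≡⟨ ∏[i<j]-suc (λ i j → x j - x i) ⟨
    ∏[i<j] (λ i j → x j - x i) ∎
    where
    x₀ = x zero
    Z : Matrix (suc n)
    Z s j = x j ^ toℕ s
    R : Rows n (suc n)
    R s = - x₀ · Z (inject₁ s) ⊕ Z (suc s)
    R-entry : ∀ s j → R s j ≡ x j ^ toℕ s * (x j - x₀)
    R-entry s j = trans (cong (λ e → - x₀ * x j ^ e + x j * x j ^ toℕ s) (toℕ-inject₁ s))
                        (factor x₀ (x j) (x j ^ toℕ s))
      where
      factor : ∀ a y z → - a * z + y * z ≡ z * (y - a)
      factor = solve-∀
    R-zero : ∀ s → R s zero ≡ 0ℤ
    R-zero s = trans (R-entry s zero) (cancel x₀ (x₀ ^ toℕ s))
      where
      cancel : ∀ a z → z * (a - a) ≡ 0ℤ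
      cancel = solve-∀
    minor≡0 : ∀ {n} (R : Rows n (suc n)) → (∀ s → R s zero ≡ 0ℤ) →
              ∀ (j : Fin n) → det (λ s k → R s (punchIn (suc j) k)) ≡ 0ℤ
    minor≡0 {suc n} R R≡0 j = det-zeroColumn (λ s k → R s (punchIn (suc j) k)) R≡0
    simplify : ∀ d p → 1ℤ * 1ℤ * (d * p) + 0ℤ ≡ p * d
    simplify = solve-∀

  -- This is n(n - 1)/2, by the recursion that sums 0, ..., n - 1.
  triangle : ℕ → ℕ
  triangle zero    = 0
  triangle (suc n) = n ℕ.+ triangle n

  -- Multiplying by this matrix on the right subtracts c times column r + 1
  -- from column r, and leaves the last column unchanged.
  subtractNext : ℤ → Matrix (suc n)
  subtractNext c zero    r = 𝟙 zero r
  subtractNext c (suc l) r = 𝟙 (suc l) r - c * 𝟙 (inject₁ l) r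

  ∏-one : {f : Vector ℤ n} → (∀ i → f i ≡ 1ℤ) → ∏ f ≡ 1ℤ
  ∏-one {zero}  f≡1 = refl
  ∏-one {suc n} f≡1 = cong₂ _*_ (f≡1 zero) (∏-one (f≡1 ∘ suc))

  det-subtractNext : ∀ n c → det (subtractNext {n} c) ≡ 1ℤ
  det-subtractNext n c = trans (det-lowerTriangular (subtractNext c) upper) (∏-one diag)
    where
    inject₁<suc : ∀ (l : Fin n) → inject₁ l < suc l
    inject₁<suc l = subst (ℕ._< suc (toℕ l)) (sym (toℕ-inject₁ l)) (ℕ.n<1+n (toℕ l))
    entry : ∀ l r {x} → inject₁ l < r → 𝟙 (suc l) r ≡ x → subtractNext c (suc l) r ≡ x
    entry l r {x} l<r e = trans (cong₂ (λ a b → a - c * b) e (𝟙-off-diagonal (<⇒≢ l<r))) (simplify c x)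
      where
      simplify : ∀ c x → x - c * 0ℤ ≡ x
      simplify = solve-∀
    upper : ∀ l r → l < r → subtractNext {n} c l r ≡ 0ℤ
    upper zero    (suc r) _   = refl
    upper (suc l) r       l<r = entry l r (ℕ.<-trans (inject₁<suc l) l<r) (𝟙-off-diagonal (<⇒≢ l<r))
    diag : ∀ l → subtractNext {n} c l l ≡ 1ℤ
    diag zero    = refl
    diag (suc l) = entry l (suc l) (inject₁<suc l) (𝟙-diagonal (suc l))

  -- The sum on the right is the entry of `w` after position `r`, or 0 when `r` is the last
  -- position; writing it as a sum covers both cases.
  ∑-subtractNext : ∀ c (w : Vector ℤ (suc n)) r →
    (∑ λ l → w l * subtractNext c l r) ≡ w r - c * (∑ λ l → 𝟙 (inject₁ l) r * w (suc l))
  ∑-subtractNext c w r = begin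
    w zero * 𝟙 zero r + (∑ λ l → w (suc l) * (𝟙 (suc l) r - c * 𝟙 (inject₁ l) r))
      ≡⟨ cong (λ x → w zero * 𝟙 zero r + x) (trans
           (sum-cong-≗ λ l → rearrange (w (suc l)) (𝟙 (suc l) r) c (𝟙 (inject₁ l) r))
           (∑-linear (- c) (λ l → 𝟙 (inject₁ l) r * w (suc l)) (λ l → 𝟙 (suc l) r * w (suc l)))) ⟩
    w zero * 𝟙 zero r + (- c * S + (∑ λ l → 𝟙 (suc l) r * w (suc l)))
      ≡⟨ collect (w zero) (𝟙 zero r) c S _ ⟩
    (∑ λ l → 𝟙 l r * w l) - c * S
      ≡⟨ cong (_- c * S) (trans (sum-cong-≗ λ l → cong (_* w l) (𝟙-comm l r)) (∑-𝟙 r w)) ⟩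
    w r - c * S ∎
    where
    S = ∑ λ l → 𝟙 (inject₁ l) r * w (suc l)
    rearrange : ∀ w a c b → w * (a - c * b) ≡ - c * (b * w) + a * w
    rearrange = solve-∀
    collect : ∀ w a c s t → w * a + (- c * s + t) ≡ a * w + t - c * s
    collect = solve-∀

  punchIn-fromℕ : ∀ (k : Fin n) → punchIn (fromℕ n) k ≡ inject₁ k
  punchIn-fromℕ zero    = refl
  punchIn-fromℕ (suc k) = cong suc (punchIn-fromℕ k)

  𝟙-inject₁ : ∀ (i j : Fin n) → 𝟙 (inject₁ i) (inject₁ j) ≡ 𝟙 i j
  𝟙-inject₁ zero    zero    = refl
  𝟙-inject₁ zero    (suc j) = refl
  𝟙-inject₁ (suc i) zero    = refl
  𝟙-inject₁ (suc i) (suc j) = 𝟙-inject₁ i j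

  inject₁≢fromℕ : ∀ (i : Fin n) → inject₁ i ≢ fromℕ n
  inject₁≢fromℕ i e = ℕ.<-irrefl (trans (sym (toℕ-inject₁ i)) (trans (cong toℕ e) (toℕ-fromℕ _))) (toℕ<n i)

  -- Subtracting `x zero` times each column from the one before it leaves only the last entry of row
  -- 0, whose cofactor has sign (-1)^n. The factors `x i - x zero` come out of the other rows, and
  -- the smaller reversed matrix remains; the signs accumulate to `triangle`.
  det-reverseVandermonde : (x : Vector ℤ n) →
    det (λ i r → x i ^ (n ∸ suc (toℕ r))) ≡ -1ℤ ^ triangle n * ∏[i<j] (λ i j → x j - x i)
  det-reverseVandermonde {zero}  x = refl
  det-reverseVandermonde {suc n} x = begin
    det W
      ≡⟨ *-identityʳ (det W) ⟨
    det W * 1ℤ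
      ≡⟨ cong (det W *_) (det-subtractNext n x₀) ⟨
    det W * det (subtractNext {n} x₀)
      ≡⟨ det-* W (subtractNext {n} x₀) ⟨
    det V
      ≡⟨⟩
    (∑ λ j → -1ℤ ^ toℕ j * V zero j * minor j)
      ≡⟨ sum-cong-≗ (λ j → trans (cong (λ e → -1ℤ ^ toℕ j * e * minor j) (V-zero j)) (rearrange (-1ℤ ^ toℕ j) _ (minor j))) ⟩
    (∑ λ j → 𝟙 (fromℕ n) j * (-1ℤ ^ toℕ j * minor j))
      ≡⟨ ∑-𝟙 (fromℕ n) (λ j → -1ℤ ^ toℕ j * minor j) ⟩
    -1ℤ ^ toℕ (fromℕ n) * minor (fromℕ n)
      ≡⟨ cong₂ (λ e d → -1ℤ ^ e * d) (toℕ-fromℕ n) (trans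
           (det-cong λ i r → trans (cong (V (suc i)) (punchIn-fromℕ r)) (V-inject₁ (suc i) r))
           (det-scaleRows _ (λ i → x (suc i) - x₀))) ⟩
    -1ℤ ^ n * (∏ (λ i → x (suc i) - x₀) * det (λ i r → x (suc i) ^ (n ∸ suc (toℕ r))))
      ≡⟨ cong (λ d → -1ℤ ^ n * (∏ (λ i → x (suc i) - x₀) * d)) (det-reverseVandermonde (x ∘ suc)) ⟩
    -1ℤ ^ n * (∏ (λ i → x (suc i) - x₀) * (-1ℤ ^ triangle n * ∏[i<j] (λ i j → x (suc j) - x (suc i))))
      ≡⟨ regroup (-1ℤ ^ n) (∏ λ i → x (suc i) - x₀) (-1ℤ ^ triangle n) (∏[i<j] λ i j → x (suc j) - x (suc i)) ⟩
    -1ℤ ^ n * -1ℤ ^ triangle n * (∏ (λ i → x (suc i) - x₀) * ∏[i<j] (λ i j → x (suc j) - x (suc i)))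
      ≡⟨ cong₂ _*_ (^-distribˡ-+-* -1ℤ n (triangle n)) (∏[i<j]-suc (λ i j → x j - x i)) ⟨
    -1ℤ ^ triangle (suc n) * ∏[i<j] (λ i j → x j - x i) ∎
    where
    x₀ = x zero
    W V : Matrix (suc n)
    W i r = x i ^ (n ∸ toℕ r)
    V i r = ∑ λ l → W i l * subtractNext x₀ l r
    minor : Fin (suc n) → ℤ
    minor j = det λ i k → V (suc i) (punchIn j k)
    rearrange : ∀ s e m → s * e * m ≡ e * (s * m)
    rearrange = solve-∀
    regroup : ∀ s p t q → s * (p * (t * q)) ≡ s * t * (p * q)
    regroup = solve-∀
    V-inject₁ : ∀ i (r : Fin n) → V i (inject₁ r) ≡ (x i - x₀) * x i ^ (n ∸ suc (toℕ r))
    V-inject₁ i r = begin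
      V i (inject₁ r)
        ≡⟨ ∑-subtractNext x₀ (W i) (inject₁ r) ⟩
      W i (inject₁ r) - x₀ * (∑ λ l → 𝟙 (inject₁ l) (inject₁ r) * W i (suc l))
        -- Column `inject₁ r` is not the last, so its exponent is positive and one factor `x i` can
        -- be split off.
        ≡⟨ cong₂ (λ a b → x i ^ a - x₀ * b)
             (trans (cong (n ∸_) (toℕ-inject₁ r))
                    (sym (ℕ.suc-pred (n ∸ toℕ r) ⦃ ℕ.>-nonZero (ℕ.m<n⇒0<n∸m (toℕ<n r)) ⦄)))
             (trans (sum-cong-≗ λ l → cong (_* W i (suc l)) (trans (𝟙-inject₁ l r) (𝟙-comm l r))) (∑-𝟙 r (W i ∘ suc))) ⟩
      x i * x i ^ ℕ.pred (n ∸ toℕ r) - x₀ * x i ^ (n ∸ suc (toℕ r))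
        ≡⟨ cong (λ e → x i * x i ^ e - x₀ * x i ^ (n ∸ suc (toℕ r))) (ℕ.pred[m∸n]≡m∸[1+n] n (toℕ r)) ⟩
      x i * x i ^ (n ∸ suc (toℕ r)) - x₀ * x i ^ (n ∸ suc (toℕ r))
        ≡⟨ factor (x i) x₀ _ ⟩
      (x i - x₀) * x i ^ (n ∸ suc (toℕ r)) ∎
      where
      factor : ∀ a b z → a * z - b * z ≡ (a - b) * z
      factor = solve-∀
    V-zero : ∀ r → V zero r ≡ 𝟙 (fromℕ n) r
    V-zero r with view r
    ... | ‵inject₁ r = begin
      V zero (inject₁ r)                          ≡⟨ V-inject₁ zero r ⟩
      (x₀ - x₀) * x₀ ^ (n ∸ suc (toℕ r))          ≡⟨ cancel x₀ _ ⟩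
      0ℤ                                          ≡⟨ 𝟙-off-diagonal (inject₁≢fromℕ r ∘ sym) ⟨
      𝟙 (fromℕ n) (inject₁ r)                     ∎
      where
      cancel : ∀ a z → (a - a) * z ≡ 0ℤ
      cancel = solve-∀
    ... | ‵fromℕ = begin
      V zero (fromℕ n)
        ≡⟨ ∑-subtractNext x₀ (W zero) (fromℕ n) ⟩
      x₀ ^ (n ∸ toℕ (fromℕ n)) - x₀ * (∑ λ l → 𝟙 (inject₁ l) (fromℕ n) * W zero (suc l))
        ≡⟨ cong₂ (λ a b → x₀ ^ a - x₀ * b) (trans (cong (n ∸_) (toℕ-fromℕ n)) (ℕ.n∸n≡0 n))
             (∑-zero λ l → trans (cong (_* W zero (suc l)) (𝟙-off-diagonal (inject₁≢fromℕ l))) (*-zeroˡ (W zero (suc l)))) ⟩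
      1ℤ - x₀ * 0ℤ
        ≡⟨ simplify x₀ ⟩
      1ℤ
        ≡⟨ 𝟙-diagonal (fromℕ n) ⟨
      𝟙 (fromℕ n) (fromℕ n) ∎
      where
      simplify : ∀ a → 1ℤ - a * 0ℤ ≡ 1ℤ
      simplify = solve-∀

  -- Matrices given by a triangular bilinear expression.

  ∑-𝟙-combination : (c : Vector ℤ l) (w : Vector ℤ n) (ρ : Fin l → Fin n) →
    (∑ λ r → ∑ λ k → c k * (𝟙 (ρ k) r * w r)) ≡ ∑ λ k → c k * w (ρ k)
  ∑-𝟙-combination c w ρ = begin
    (∑ λ r → ∑ λ k → c k * (𝟙 (ρ k) r * w r))
      ≡⟨ ∑-comm (λ r k → c k * (𝟙 (ρ k) r * w r)) ⟩
    (∑ λ k → ∑ λ r → c k * (𝟙 (ρ k) r * w r))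
      ≡⟨ sum-cong-≗ (λ k → trans (sym (*-distribˡ-sum (c k) (λ r → 𝟙 (ρ k) r * w r))) (cong (c k *_) (∑-𝟙 (ρ k) w))) ⟩
    (∑ λ k → c k * w (ρ k)) ∎

  -- The matrix factors as w K z, where K is lower triangular with diagonal α
  -- because each k contributes only at position (ρ k, σ k).
  det-bilinear : (w z : Matrix n) (α : Vector ℤ n) (β : Vector ℤ l) (ρ σ : Fin l → Fin n) →
    (∀ k → σ k < ρ k) →
    det (λ i j → (∑ λ s → α s * (w i s * z s j)) + (∑ λ k → β k * (w i (ρ k) * z (σ k) j)))
      ≡ det w * ∏ α * det z
  det-bilinear {n} {l} w z α β ρ σ σ<ρ = begin
    det (λ i j → (∑ λ s → α s * (w i s * z s j)) + (∑ λ k → β k * (w i (ρ k) * z (σ k) j)))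
      ≡⟨ det-cong wKz ⟨
    det (λ i j → ∑ λ s → (∑ λ r → w i r * K r s) * z s j)
      ≡⟨ det-* (λ i s → ∑ λ r → w i r * K r s) z ⟩
    det (λ i s → ∑ λ r → w i r * K r s) * det z
      ≡⟨ cong (_* det z) (det-* w K) ⟩
    det w * det K * det z
      ≡⟨ cong (λ x → det w * x * det z) (trans (det-lowerTriangular K K-upper) (∏-cong K-diagonal)) ⟩
    det w * ∏ α * det z ∎
    where
    K : Matrix n
    K r s = α s * 𝟙 s r + ∑ λ k → β k * (𝟙 (ρ k) r * 𝟙 (σ k) s)
    wK : ∀ i s → (∑ λ r → w i r * K r s) ≡ α s * w i s + ∑ λ k → β k * 𝟙 (σ k) s * w i (ρ k)
    wK i s = begin
      (∑ λ r → w i r * K r s)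
        ≡⟨ sum-cong-≗ (λ r → trans (expand (w i r) (α s) (𝟙 s r) (∑ λ k → β k * (𝟙 (ρ k) r * 𝟙 (σ k) s)))
             (cong (λ x → α s * (𝟙 s r * w i r) + x) (trans (*-distribˡ-sum (w i r) (λ k → β k * (𝟙 (ρ k) r * 𝟙 (σ k) s)))
               (sum-cong-≗ λ k → rearrange (w i r) (β k) (𝟙 (ρ k) r) (𝟙 (σ k) s))))) ⟩
      (∑ (α s · (λ r → 𝟙 s r * w i r) ⊕ λ r → ∑ λ k → β k * 𝟙 (σ k) s * (𝟙 (ρ k) r * w i r)))
        ≡⟨ ∑-linear (α s) (λ r → 𝟙 s r * w i r) (λ r → ∑ λ k → β k * 𝟙 (σ k) s * (𝟙 (ρ k) r * w i r)) ⟩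
      α s * (∑ λ r → 𝟙 s r * w i r) + (∑ λ r → ∑ λ k → β k * 𝟙 (σ k) s * (𝟙 (ρ k) r * w i r))
        ≡⟨ cong₂ (λ a b → α s * a + b) (∑-𝟙 s (w i)) (∑-𝟙-combination (λ k → β k * 𝟙 (σ k) s) (w i) ρ) ⟩
      α s * w i s + (∑ λ k → β k * 𝟙 (σ k) s * w i (ρ k)) ∎
      where
      expand : ∀ w a e x → w * (a * e + x) ≡ a * (e * w) + w * x
      expand = solve-∀
      rearrange : ∀ w b e f → w * (b * (e * f)) ≡ b * f * (e * w)
      rearrange = solve-∀
    wKz : ∀ i j → (∑ λ s → (∑ λ r → w i r * K r s) * z s j)
          ≡ (∑ λ s → α s * (w i s * z s j)) + (∑ λ k → β k * (w i (ρ k) * z (σ k) j))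
    wKz i j = begin
      (∑ λ s → (∑ λ r → w i r * K r s) * z s j)
        ≡⟨ sum-cong-≗ (λ s → trans (cong (_* z s j) (wK i s)) (trans (expand (α s) (w i s) (z s j) _)
             (cong (λ x → α s * (w i s * z s j) + x) (trans (*-distribʳ-sum (z s j) (λ k → β k * 𝟙 (σ k) s * w i (ρ k)))
               (sum-cong-≗ λ k → rearrange (β k) (𝟙 (σ k) s) (w i (ρ k)) (z s j)))))) ⟩
      (∑ λ s → α s * (w i s * z s j) + (∑ λ k → β k * w i (ρ k) * (𝟙 (σ k) s * z s j)))
        ≡⟨ ∑-distrib-+ (λ s → α s * (w i s * z s j)) (λ s → ∑ λ k → β k * w i (ρ k) * (𝟙 (σ k) s * z s j)) ⟩
      (∑ λ s → α s * (w i s * z s j)) + (∑ λ s → ∑ λ k → β k * w i (ρ k) * (𝟙 (σ k) s * z s j))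
        ≡⟨ cong (λ x → (∑ λ s → α s * (w i s * z s j)) + x) (trans
             (∑-𝟙-combination (λ k → β k * w i (ρ k)) (λ s → z s j) σ)
             (sum-cong-≗ λ k → *-assoc (β k) (w i (ρ k)) (z (σ k) j))) ⟩
      (∑ λ s → α s * (w i s * z s j)) + (∑ λ k → β k * (w i (ρ k) * z (σ k) j)) ∎
      where
      expand : ∀ a w z x → (a * w + x) * z ≡ a * (w * z) + x * z
      expand = solve-∀
      rearrange : ∀ b f w z → b * f * w * z ≡ b * w * (f * z)
      rearrange = solve-∀
    corner≡0 : ∀ r s → r ≤ s → (∑ λ k → β k * (𝟙 (ρ k) r * 𝟙 (σ k) s)) ≡ 0ℤ
    corner≡0 r s r≤s = ∑-zero λ k → trans (cong (β k *_) (vanish k)) (*-zeroʳ (β k))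
      where
      vanish : ∀ k → 𝟙 (ρ k) r * 𝟙 (σ k) s ≡ 0ℤ
      vanish k with ρ k ≟ r
      ... | yes refl = trans (cong (𝟙 (ρ k) r *_) (𝟙-off-diagonal (<⇒≢ (ℕ.<-≤-trans (σ<ρ k) r≤s)))) (*-zeroʳ (𝟙 (ρ k) r))
      ... | no ρ≢r   = trans (cong (_* 𝟙 (σ k) s) (𝟙-off-diagonal ρ≢r)) (*-zeroˡ (𝟙 (σ k) s))
    K-upper : ∀ r s → r < s → K r s ≡ 0ℤ
    K-upper r s r<s = trans
      (cong₂ (λ a b → α s * a + b) (𝟙-off-diagonal (<⇒≢ r<s ∘ sym)) (corner≡0 r s (ℕ.<⇒≤ r<s)))
      (simplify (α s))
      where
      simplify : ∀ a → a * 0ℤ + 0ℤ ≡ 0ℤ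
      simplify = solve-∀
    K-diagonal : ∀ s → K s s ≡ α s
    K-diagonal s = trans
      (cong₂ (λ a b → α s * a + b) (𝟙-diagonal s) (corner≡0 s s ℕ.≤-refl))
      (simplify (α s))
      where
      simplify : ∀ a → a * 1ℤ + 0ℤ ≡ a
      simplify = solve-∀

open Determinant

-- The binomial theorem and binomial coefficients of a prime.

binomial-theorem : ∀ n x y → (x + y) ^ n ≡ ∑ λ (k : Fin (suc n)) → + (n C toℕ k) * (x ^ toℕ k * y ^ (n ∸ toℕ k))
binomial-theorem n x y = begin
  (x + y) ^ n
    ≡⟨ ^-agree (x + y) n ⟨
  (x + y) ^ˢ n
    ≡⟨ Binomial.theorem n x y ⟩
  (∑ λ (k : Fin (suc n)) → (n C toℕ k) ×ˢ (x ^ˢ toℕ k * y ^ˢ (n ∸ toℕ k)))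
    ≡⟨ sum-cong-≗ {suc n} (λ k → trans (×-agree (n C toℕ k) (x ^ˢ toℕ k * y ^ˢ (n ∸ toℕ k)))
         (cong (+ (n C toℕ k) *_) (cong₂ _*_ (^-agree x (toℕ k)) (^-agree y (n ∸ toℕ k))))) ⟩
  (∑ λ (k : Fin (suc n)) → + (n C toℕ k) * (x ^ toℕ k * y ^ (n ∸ toℕ k))) ∎
  where
  open ≡-Reasoning
  ^-agree : ∀ x n → x ^ˢ n ≡ x ^ n
  ^-agree x zero    = refl
  ^-agree x (suc n) = cong (x *_) (^-agree x n)
  ×-agree : ∀ n x → n ×ˢ x ≡ + n * x
  ×-agree zero    x = sym (*-zeroˡ x)
  ×-agree (suc n) x = begin
    x + n ×ˢ x             ≡⟨ cong (λ y → x + y) (×-agree n x) ⟩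
    x + + n * x            ≡⟨ collect x (+ n) ⟩
    (1ℤ + + n) * x         ∎
    where
    collect : ∀ x a → x + a * x ≡ (1ℤ + a) * x
    collect = solve-∀

-- Division is avoided by using Pascal's rule twice: to split the coefficient, and to recombine the
-- two induction hypotheses.
C-absorption : ∀ n k → suc k ℕ.* (suc n C suc k) ≡ suc n ℕ.* (n C k)
C-absorption zero    zero    = refl
C-absorption zero    (suc k) = ℕ.*-zeroʳ (suc (suc k))
C-absorption (suc n) zero    = trans (ℕ.*-identityˡ _) (trans (nC1≡n (suc (suc n))) (sym (ℕ.*-identityʳ (suc (suc n)))))
C-absorption (suc n) (suc k) = begin
  suc (suc k) ℕ.* (suc (suc n) C suc (suc k))
    ≡⟨ cong (suc (suc k) ℕ.*_) (nCk+nC[k+1]≡[n+1]C[k+1] (suc n) (suc k)) ⟨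
  suc (suc k) ℕ.* (c ℕ.+ c′)
    ≡⟨ expand (suc k) c c′ ⟩
  c ℕ.+ (suc k ℕ.* c ℕ.+ suc (suc k) ℕ.* c′)
    ≡⟨ cong₂ (λ a b → c ℕ.+ (a ℕ.+ b)) (C-absorption n k) (C-absorption n (suc k)) ⟩
  c ℕ.+ (suc n ℕ.* (n C k) ℕ.+ suc n ℕ.* (n C suc k))
    ≡⟨ cong (c ℕ.+_) (ℕ.*-distribˡ-+ (suc n) (n C k) (n C suc k)) ⟨
  c ℕ.+ suc n ℕ.* (n C k ℕ.+ n C suc k)
    ≡⟨ cong (λ x → c ℕ.+ suc n ℕ.* x) (nCk+nC[k+1]≡[n+1]C[k+1] n k) ⟩
  suc (suc n) ℕ.* c ∎
  where
  open ≡-Reasoning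
  c c′ : ℕ
  c  = suc n C suc k
  c′ = suc n C suc (suc k)
  expand : ∀ j a b → suc j ℕ.* (a ℕ.+ b) ≡ a ℕ.+ (j ℕ.* a ℕ.+ suc j ℕ.* b)
  expand = ℕ-Solver.solve-∀

-- By absorption `p` divides k C(p,k), and it cannot divide the smaller positive number k.
p∣pCk : ∀ {p k} → Prime p → 0 ℕ.< k → k ℕ.< p → p ℕ.∣ (p C k)
p∣pCk {suc q} {suc k} p-prime 0<k k<p
  with euclidsLemma (suc k) (suc q C suc k) p-prime (ℕ.divides (q C k) (trans (C-absorption q k) (ℕ.*-comm (suc q) (q C k))))
... | inj₁ p∣k = contradiction p∣k (ℕ.>⇒∤ k<p)
... | inj₂ p∣C = p∣C

-- Arithmetic modulo p.

module Congruence (p : ℕ) where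

  -- A record rather than a synonym, so that both sides can be inferred.
  infix 4 _≈_
  record _≈_ (x y : ℤ) : Set where
    constructor mod
    field congruence : x ≡ y [mod p ]
  open _≈_ public

  ≈-reflexive : ∀ {x y} → x ≡ y → x ≈ y
  ≈-reflexive {x} refl = mod (divides 0ℤ (cancel x))
    where
    cancel : ∀ x → x - x ≡ 0ℤ
    cancel = solve-∀

  setoid : Setoid _ _
  setoid = record
    { _≈_ = _≈_
    ; isEquivalence = record
      { refl  = ≈-reflexive refl
      ; sym   = λ {x} {y} (mod h) → mod (≡-sym p {x} {y} h)
      ; trans = λ {x} {y} {z} (mod h) (mod k) → mod (≡-trans p {x} {y} {z} h k)
      }
    }

  open Setoid setoid public using () renaming (refl to ≈-refl; sym to ≈-sym; trans to ≈-trans)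
  open SetoidReasoning setoid

  +-cong : ∀ {x x′ y y′} → x ≈ x′ → y ≈ y′ → x + y ≈ x′ + y′
  +-cong {x} {x′} {y} {y′} (mod h) (mod k) = mod
    (subst (+ p ∣ℤ_) (regroup x x′ y y′) (∣m∣n⇒∣m+n h k))
    where
    regroup : ∀ x x′ y y′ → x - x′ + (y - y′) ≡ x + y - (x′ + y′)
    regroup = solve-∀

  *-cong : ∀ {x x′ y y′} → x ≈ x′ → y ≈ y′ → x * y ≈ x′ * y′
  *-cong {x} {x′} {y} {y′} (mod h) (mod k) = mod
    (subst (+ p ∣ℤ_) (regroup x x′ y y′) (∣m∣n⇒∣m+n (∣m⇒∣m*n y h) (∣n⇒∣m*n x′ k)))
    where
    regroup : ∀ x x′ y y′ → (x - x′) * y + x′ * (y - y′) ≡ x * y - x′ * y′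
    regroup = solve-∀

  ^-cong : ∀ {x y} n → x ≈ y → x ^ n ≈ y ^ n
  ^-cong zero    x≈y = ≈-refl
  ^-cong (suc n) x≈y = *-cong x≈y (^-cong n x≈y)

  ∑-cong-≈ : {f g : Vector ℤ n} → (∀ i → f i ≈ g i) → ∑ f ≈ ∑ g
  ∑-cong-≈ {zero}  f≈g = ≈-refl
  ∑-cong-≈ {suc n} f≈g = +-cong (f≈g zero) (∑-cong-≈ (f≈g ∘ suc))

  det-cong-≈ : {M N : Matrix n} → (∀ i j → M i j ≈ N i j) → det M ≈ det N
  det-cong-≈ {zero}  M≈N = ≈-refl
  det-cong-≈ {suc n} M≈N = ∑-cong-≈ λ j →
    *-cong (*-cong (≈-refl { -1ℤ ^ toℕ j}) (M≈N zero j)) (det-cong-≈ λ i k → M≈N (suc i) (punchIn j k))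

  x≈y⇒x-y≈0 : ∀ {x y} → x ≈ y → x - y ≈ 0ℤ
  x≈y⇒x-y≈0 {x} {y} (mod h) = mod (subst (+ p ∣ℤ_) (sym (+-identityʳ (x - y))) h)

  x-y≈0⇒x≈y : ∀ {x y} → x - y ≈ 0ℤ → x ≈ y
  x-y≈0⇒x≈y {x} {y} (mod h) = mod (subst (+ p ∣ℤ_) (+-identityʳ (x - y)) h)

  p∣k⇒+k≈0 : p ℕ.∣ k → + k ≈ 0ℤ
  p∣k⇒+k≈0 {k} p∣k = mod (subst (+ p ∣ℤ_) (sym (+-identityʳ (+ k))) (∣ᵤ⇒∣ p∣k))

  ≈0⇒p∣abs : ∀ {x} → x ≈ 0ℤ → p ℕ.∣ ∣ x ∣
  ≈0⇒p∣abs {x} (mod h) = ∣⇒∣ᵤ (subst (+ p ∣ℤ_) (+-identityʳ x) h)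

  -- Prime modulus: zero divisors, Fermat's little theorem, roots of unity.

  module Field (p-prime : Prime p) where

    x*y≈0⇒x≈0∨y≈0 : ∀ x y → x * y ≈ 0ℤ → x ≈ 0ℤ ⊎ y ≈ 0ℤ
    x*y≈0⇒x≈0∨y≈0 x y xy≈0 =
      [ inj₁ ∘ from x , inj₂ ∘ from y ]′
        (euclidsLemma ∣ x ∣ ∣ y ∣ p-prime (subst (p ℕ.∣_) (abs-* x y) (≈0⇒p∣abs xy≈0)))
      where
      from : ∀ z → p ℕ.∣ ∣ z ∣ → z ≈ 0ℤ
      from z p∣z = mod (subst (+ p ∣ℤ_) (sym (+-identityʳ z)) (∣ᵤ⇒∣ p∣z))

    +k≉0 : 0 ℕ.< k → k ℕ.< p → ¬ + k ≈ 0ℤ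
    +k≉0 {suc k} _ k<p k≈0 = ℕ.>⇒∤ k<p (≈0⇒p∣abs k≈0)

    ∏≈0⇒∃≈0 : (f : Vector ℤ n) → ∏ f ≈ 0ℤ → ∃ λ i → f i ≈ 0ℤ
    ∏≈0⇒∃≈0 {zero}  f ∏≈0 = contradiction (ℕ.∣1⇒≡1 (≈0⇒p∣abs ∏≈0)) λ { refl → ¬prime[1] p-prime }
    ∏≈0⇒∃≈0 {suc n} f ∏≈0 with x*y≈0⇒x≈0∨y≈0 (f zero) (∏ (f ∘ suc)) ∏≈0
    ... | inj₁ f0≈0 = zero , f0≈0
    ... | inj₂ ∏≈0′ with ∏≈0⇒∃≈0 (f ∘ suc) ∏≈0′
    ...   | i , fi≈0 = suc i , fi≈0

    ∏[i<j]≈0⇒∃≈0 : (f : Fin n → Fin n → ℤ) → ∏[i<j] f ≈ 0ℤ → ∃₂ λ i j → i < j × f i j ≈ 0ℤ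
    ∏[i<j]≈0⇒∃≈0 f ∏≈0 with ∏≈0⇒∃≈0 (λ i → ∏ λ j → if does (i <? j) then f i j else 1ℤ) ∏≈0
    ... | i , ∏ᵢ≈0 with ∏≈0⇒∃≈0 (λ j → if does (i <? j) then f i j else 1ℤ) ∏ᵢ≈0
    ...   | j , fij≈0 with toℕ i ℕ.<ᵇ toℕ j in i<ᵇj
    ...     | true  = i , j , ℕ.<ᵇ⇒< (toℕ i) (toℕ j) (subst T (sym i<ᵇj) tt) , fij≈0
    -- Pairs outside `i < j` contribute the default factor 1, which is nonzero modulo a prime.
    ...     | false = contradiction (ℕ.∣1⇒≡1 (≈0⇒p∣abs fij≈0)) λ { refl → ¬prime[1] p-prime }

    -- All binomial coefficients except the first and the last are divisible by `p`.
    frobenius : ∀ x y → (x + y) ^ p ≈ x ^ p + y ^ p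
    frobenius x y = go p refl
      where
      -- The fixed modulus is passed as a variable with an equation, so that it can be matched as a
      -- successor.
      go : ∀ q → q ≡ p → (x + y) ^ q ≈ x ^ q + y ^ q
      go zero    refl = contradiction p-prime ¬prime[0]
      go (suc q) refl = begin
        (x + y) ^ suc q
          ≡⟨ binomial-theorem (suc q) x y ⟩
        t zero + ∑ (t ∘ suc)
          ≡⟨ cong (λ s → t zero + s) (sum-init-last (t ∘ suc)) ⟩
        t zero + (∑ (t ∘ suc ∘ inject₁) + t (suc (fromℕ q)))
          ≈⟨ +-cong (≈-refl {t zero}) (+-cong {∑ (t ∘ suc ∘ inject₁)}
               (≈-trans (∑-cong-≈ middle) (≈-reflexive (∑-zero {f = λ (_ : Fin q) → 0ℤ} λ _ → refl)))
               (≈-refl {t (suc (fromℕ q))})) ⟩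
        t zero + (0ℤ + t (suc (fromℕ q)))
          ≡⟨ cong (λ s → t zero + (0ℤ + s)) last ⟩
        1ℤ * (1ℤ * y ^ suc q) + (0ℤ + x ^ suc q)
          ≡⟨ simplify (x ^ suc q) (y ^ suc q) ⟩
        x ^ suc q + y ^ suc q ∎
        where
        t : Fin (suc (suc q)) → ℤ
        t k = + (suc q C toℕ k) * (x ^ toℕ k * y ^ (suc q ∸ toℕ k))
        simplify : ∀ a b → 1ℤ * (1ℤ * b) + (0ℤ + a) ≡ a + b
        simplify = solve-∀
        middle : ∀ k → t (suc (inject₁ k)) ≈ 0ℤ
        middle k = ≈-trans
          (*-cong (p∣k⇒+k≈0 (p∣pCk p-prime z<s (s<s (subst (ℕ._< q) (sym (toℕ-inject₁ k)) (toℕ<n k)))))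
            (≈-refl {x ^ suc (toℕ (inject₁ k)) * y ^ (q ∸ toℕ (inject₁ k))}))
          (≈-reflexive (*-zeroˡ (x ^ suc (toℕ (inject₁ k)) * y ^ (q ∸ toℕ (inject₁ k)))))
        last : t (suc (fromℕ q)) ≡ x ^ suc q
        last = trans (cong (λ e → + (suc q C suc e) * (x ^ suc e * y ^ (q ∸ e))) (toℕ-fromℕ q))
          (trans (cong₂ (λ c e → + c * (x ^ suc q * y ^ e)) (nCn≡1 (suc q)) (ℕ.n∸n≡0 q))
                 (simplify′ (x ^ suc q)))
          where
          simplify′ : ∀ a → 1ℤ * (a * 1ℤ) ≡ a
          simplify′ = solve-∀

    fermat-ℕ : ∀ k → (+ k) ^ p ≈ + k
    fermat-ℕ zero    = go p refl
      where
      go : ∀ q → q ≡ p → 0ℤ ^ q ≈ 0ℤ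
      go zero    refl = contradiction p-prime ¬prime[0]
      go (suc q) refl = ≈-reflexive (*-zeroˡ (0ℤ ^ q))
    fermat-ℕ (suc k) = begin
      (1ℤ + + k) ^ p          ≈⟨ frobenius 1ℤ (+ k) ⟩
      1ℤ ^ p + (+ k) ^ p      ≈⟨ +-cong (≈-reflexive (^-zeroˡ p)) (fermat-ℕ k) ⟩
      1ℤ + + k                ∎

    fermat : ∀ x → x ^ p ≈ x
    fermat x = begin
      x ^ p            ≈⟨ ^-cong p residue ⟩
      (+ r) ^ p        ≈⟨ fermat-ℕ r ⟩
      + r              ≈⟨ residue ⟨
      x                ∎
      where
      instance _ = prime⇒nonZero p-prime
      r = x %ℕ p
      residue : x ≈ + r
      residue = mod (divides (x /ℕ p) (trans (cong (_- + r) (a≡a%ℕn+[a/ℕn]*n x p)) (cancel (+ r) (x /ℕ p * + p))))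
        where
        cancel : ∀ a b → a + b - a ≡ b
        cancel = solve-∀

    -- Exponents in the Vandermonde matrix of the x j may be reduced modulo
    -- h, after which its first and last rows coincide.
    h+1-roots-repeat : ∀ h .⦃ _ : NonZero h ⦄ (x : Vector ℤ (suc h)) → (∀ j → x j ^ h ≈ 1ℤ) →
                       ∃₂ λ i j → i < j × x j ≈ x i
    h+1-roots-repeat h@(suc h-1) x roots = repeated (∏[i<j]≈0⇒∃≈0 (λ i j → x j - x i) (begin
      ∏[i<j] (λ i j → x j - x i)          ≡⟨ det-vandermonde x ⟨
      det (λ s j → x j ^ toℕ s)
        ≈⟨ det-cong-≈ {M = λ s j → x j ^ toℕ s} {N = R} (λ s j → reduce (roots j) (toℕ s)) ⟩
      det R                               ≡⟨ det-cong (∷-η R) ⟩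
      det (R zero ∷ (R ∘ suc))
        ≡⟨ repeat⇒0 h det-cong (det-alternating h+1) (R zero) (R ∘ suc) (fromℕ h-1)
                                               (λ j → cong (x j ^_) (trans (cong (λ e → suc e % h) (toℕ-fromℕ h-1)) (n%n≡0 h))) ⟩
      0ℤ                                  ∎))
      where
      h+1 = suc h
      R : Matrix h+1
      R s j = x j ^ (toℕ s % h)
      repeated : (∃₂ λ i j → i < j × x j - x i ≈ 0ℤ) → ∃₂ λ i j → i < j × x j ≈ x i
      repeated (i , j , i<j , d≈0) = i , j , i<j , x-y≈0⇒x≈y d≈0
      reduce : ∀ {y} → y ^ h ≈ 1ℤ → ∀ s → y ^ s ≈ y ^ (s % h)
      reduce {y} y^h≈1 s = begin
        y ^ s
          ≡⟨ cong (y ^_) (trans (m≡m%n+[m/n]*n s h) (cong (s % h ℕ.+_) (ℕ.*-comm (s / h) h))) ⟩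
        y ^ (s % h ℕ.+ h ℕ.* (s / h))           ≡⟨ ^-distribˡ-+-* y (s % h) (h ℕ.* (s / h)) ⟩
        y ^ (s % h) * y ^ (h ℕ.* (s / h))       ≡⟨ cong (y ^ (s % h) *_) (^-*-assoc y h (s / h)) ⟨
        y ^ (s % h) * (y ^ h) ^ (s / h)         ≈⟨ *-cong (≈-refl {y ^ (s % h)}) (^-cong (s / h) y^h≈1) ⟩
        y ^ (s % h) * 1ℤ ^ (s / h)              ≡⟨ cong (y ^ (s % h) *_) (^-zeroˡ (s / h)) ⟩
        y ^ (s % h) * 1ℤ                        ≡⟨ *-identityʳ (y ^ (s % h)) ⟩
        y ^ (s % h)                             ∎

    -- Euler's criterion.

    module Euler (h : ℕ) (p≡1+h+h : p ≡ suc (h ℕ.+ h)) where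

      instance
        h-nonZero : NonZero h
        h-nonZero = go h p≡1+h+h
          where
          go : ∀ h → p ≡ suc (h ℕ.+ h) → NonZero h
          go zero    refl = contradiction p-prime ¬prime[1]
          go (suc h) _    = _

      -- One factor `x` is cancelled from Fermat's congruence.
      unit-power : ∀ {x} → ¬ x ≈ 0ℤ → x ^ (h ℕ.+ h) ≈ 1ℤ
      unit-power {x} x≉0 = [ (λ x≈0 → contradiction x≈0 x≉0) , x-y≈0⇒x≈y ]′
        (x*y≈0⇒x≈0∨y≈0 x (x ^ (h ℕ.+ h) - 1ℤ) (begin
          x * (x ^ (h ℕ.+ h) - 1ℤ)    ≡⟨ expand x (x ^ (h ℕ.+ h)) ⟩
          x ^ suc (h ℕ.+ h) - x       ≡⟨ cong (λ e → x ^ e - x) p≡1+h+h ⟨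
          x ^ p - x                   ≈⟨ x≈y⇒x-y≈0 (fermat x) ⟩
          0ℤ                          ∎))
        where
        expand : ∀ x y → x * (y - 1ℤ) ≡ x * y - x
        expand = solve-∀

      square-power : ∀ x → (x ^ 2) ^ h ≡ x ^ (h ℕ.+ h)
      square-power x = trans (^-*-assoc x 2 h) (cong (λ e → x ^ (h ℕ.+ e)) (ℕ.+-identityʳ h))

      square⇒1 : ∀ {t} → ¬ t ≈ 0ℤ → IsSquare p t → t ^ h ≈ 1ℤ
      square⇒1 {t} t≉0 (x , x²≡t) = begin
        t ^ h                         ≈⟨ ^-cong h x²≈t ⟨
        ((+ toℕ x) ^ 2) ^ h           ≡⟨ square-power (+ toℕ x) ⟩
        (+ toℕ x) ^ (h ℕ.+ h)         ≈⟨ unit-power (λ x≈0 → t≉0 (≈-trans (≈-sym x²≈t) (^-cong 2 x≈0))) ⟩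
        1ℤ                            ∎
        where
        x²≈t : (+ toℕ x) ^ 2 ≈ t
        x²≈t = mod x²≡t

      -- Among the h + 1 roots `t`, 1^2, ..., h^2 two must coincide. The listed squares are pairwise
      -- incongruent, so `t` is congruent to one of them.
      1⇒square : ∀ {t} → t ^ h ≈ 1ℤ → IsSquare p t
      1⇒square {t} t^h≈1 = coincidence (h+1-roots-repeat h x roots)
        where
        x : Vector ℤ (suc h)
        x = t ∷ λ k → (+ suc (toℕ k)) ^ 2
        h<p : h ℕ.< p
        h<p = subst (h ℕ.<_) (sym p≡1+h+h) (s≤s (ℕ.m≤m+n h h))
        roots : ∀ j → x j ^ h ≈ 1ℤ
        roots zero    = t^h≈1
        roots (suc k) = ≈-trans (≈-reflexive (square-power (+ suc (toℕ k))))
          (unit-power (+k≉0 z<s (ℕ.≤-<-trans (toℕ<n k) h<p)))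
        -- Both factors of (b + 1)^2 - (a + 1)^2 lie strictly between 0 and p, since the sum of the
        -- bases is at most 2h.
        distinct : ∀ a b → a ℕ.< b → b ℕ.< h → ¬ (+ suc b) ^ 2 ≈ (+ suc a) ^ 2
        distinct a b a<b b<h b²≈a² =
          [ +k≉0 (ℕ.m<n⇒0<n∸m a<b) (ℕ.≤-<-trans (ℕ.m∸n≤m b a) (ℕ.<-trans b<h h<p))
          , +k≉0 z<s (subst (suc b ℕ.+ suc a ℕ.<_) (sym p≡1+h+h) (s≤s (ℕ.+-mono-≤ b<h (ℕ.<-trans a<b b<h))))
          ]′ (x*y≈0⇒x≈0∨y≈0 (+ (b ∸ a)) (+ (suc b ℕ.+ suc a)) (begin
            + (b ∸ a) * (+ suc b + + suc a)
              ≡⟨ cong (_* (+ suc b + + suc a)) (trans ([+m]-[+n]≡m⊖n (suc b) (suc a)) (⊖-≥ (s≤s (ℕ.<⇒≤ a<b)))) ⟨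
            (+ suc b - + suc a) * (+ suc b + + suc a)     ≡⟨ difference (+ suc b) (+ suc a) ⟩
            (+ suc b) ^ 2 - (+ suc a) ^ 2                 ≈⟨ x≈y⇒x-y≈0 b²≈a² ⟩
            0ℤ                                            ∎))
          where
          difference : ∀ x y → (x - y) * (x + y) ≡ x * (x * 1ℤ) - y * (y * 1ℤ)
          difference = solve-∀
        coincidence : (∃₂ λ i j → i < j × x j ≈ x i) → IsSquare p t
        coincidence (zero  , suc b , _ , b²≈t) = fromℕ< b<p ,
          congruence (≈-trans (≈-reflexive (cong (λ e → (+ e) ^ 2) (toℕ-fromℕ< b<p))) b²≈t)
          where
          b<p : suc (toℕ b) ℕ.< p
          b<p = ℕ.≤-<-trans (toℕ<n b) h<p
        coincidence (suc a , suc b , s<s a<b , b²≈a²) = contradiction b²≈a² (distinct (toℕ a) (toℕ b) a<b (toℕ<n b))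

      -- The power `t ^ h` is a square root of 1, hence 1 or -1, and the value 1 would make `t` a
      -- square.
      nonsquare⇒-1 : ∀ {t} → ¬ t ≈ 0ℤ → ¬ IsSquare p t → t ^ h ≈ -1ℤ
      nonsquare⇒-1 {t} t≉0 t≠□ =
        [ (λ t^h-1≈0 → contradiction (1⇒square (x-y≈0⇒x≈y t^h-1≈0)) t≠□) , x-y≈0⇒x≈y ]′
        (x*y≈0⇒x≈0∨y≈0 (t ^ h - 1ℤ) (t ^ h - -1ℤ) (begin
          (t ^ h - 1ℤ) * (t ^ h - -1ℤ)    ≡⟨ difference (t ^ h) ⟩
          t ^ h * t ^ h - 1ℤ              ≡⟨ cong (_- 1ℤ) (^-distribˡ-+-* t h h) ⟨
          t ^ (h ℕ.+ h) - 1ℤ              ≈⟨ x≈y⇒x-y≈0 (unit-power t≉0) ⟩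
          0ℤ                              ∎))
        where
        difference : ∀ x → (x - 1ℤ) * (x - -1ℤ) ≡ x * x - 1ℤ
        difference = solve-∀

      euler-criterion : ∀ t → χ p t ≈ t ^ h
      euler-criterion t = cases (t ≡? 0ℤ [mod p ]) (isSquare? p t)
        (λ t≡0 → ≈-sym (≈-trans (^-cong h (mod t≡0)) (≈-reflexive (zero-power h))))
        (λ t≢0 t=□ → ≈-sym (square⇒1 (t≢0 ∘ congruence) t=□))
        (λ t≢0 t≠□ → ≈-sym (nonsquare⇒-1 (t≢0 ∘ congruence) t≠□))
        where
        -- Requires a nonzero exponent, because 0 ^ 0 is 1.
        zero-power : ∀ h .⦃ _ : NonZero h ⦄ → 0ℤ ^ h ≡ 0ℤ
        zero-power (suc h) = *-zeroˡ (0ℤ ^ h)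
        -- Both decisions are generalised so that matching on them reduces the nested conditional in
        -- `χ`.
        cases : ∀ {A B : Set} {r} (a? : Dec A) (b? : Dec B) →
                (A → 0ℤ ≈ r) → (¬ A → B → 1ℤ ≈ r) → (¬ A → ¬ B → -1ℤ ≈ r) →
                (if does a? then 0ℤ else if does b? then 1ℤ else -1ℤ) ≈ r
        cases (yes a) _       f g h = f a
        cases (no ¬a) (yes b) f g h = g ¬a b
        cases (no ¬a) (no ¬b) f g h = h ¬a ¬b

-- The sum of the h-th powers of a + b and a - b in terms of squares.

≡⌊/2⌋+⌊/2⌋ : ∀ k → k ≡ ⌊ k /2⌋ ℕ.+ ⌊ k /2⌋ ⊎ k ≡ suc (⌊ k /2⌋ ℕ.+ ⌊ k /2⌋)
≡⌊/2⌋+⌊/2⌋ zero          = inj₁ refl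
≡⌊/2⌋+⌊/2⌋ (suc zero)    = inj₂ refl
≡⌊/2⌋+⌊/2⌋ (suc (suc k)) = Sum.map step step (≡⌊/2⌋+⌊/2⌋ k)
  where
  step : ∀ {a b} → a ≡ b ℕ.+ ⌊ k /2⌋ → suc (suc a) ≡ suc (b ℕ.+ suc ⌊ k /2⌋)
  step {b = b} e = cong suc (trans (cong suc e) (sym (ℕ.+-suc b ⌊ k /2⌋)))

^-double : ∀ x q → x ^ (q ℕ.+ q) ≡ (x ^ 2) ^ q
^-double x q = trans (cong (λ e → x ^ (q ℕ.+ e)) (sym (ℕ.+-identityʳ q))) (sym (^-*-assoc x 2 q))

neg-^ : ∀ x n → (- x) ^ n ≡ -1ℤ ^ n * x ^ n
neg-^ x zero    = refl
neg-^ x (suc n) = trans (cong (- x *_) (neg-^ x n)) (rearrange x (-1ℤ ^ n) (x ^ n))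
  where
  rearrange : ∀ x s y → - x * (s * y) ≡ -1ℤ * s * (x * y)
  rearrange = solve-∀

-- The common factor vanishes for odd `k`, so the halved exponents need to be correct only for even
-- `k`. The exponent m - k/2 of `a ^ 2` is written as 2m minus an index, because these powers will
-- be listed in descending order.
parity-term : ∀ m k a b → (1ℤ + -1ℤ ^ k) * (b ^ k * a ^ (2 ℕ.* m ∸ k)) ≡
  (1ℤ + -1ℤ ^ k) * ((a ^ 2) ^ (2 ℕ.* m ∸ (m ℕ.+ ⌊ k /2⌋)) * (b ^ 2) ^ ⌊ k /2⌋)
parity-term m k a b with ≡⌊/2⌋+⌊/2⌋ k
... | inj₁ k≡q+q = cong ((1ℤ + -1ℤ ^ k) *_) (begin
  b ^ k * a ^ (2 ℕ.* m ∸ k)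
    ≡⟨ cong₂ (λ x y → x * a ^ y) (trans (cong (b ^_) k≡q+q) (^-double b q)) exponent ⟩
  (b ^ 2) ^ q * a ^ (2 ℕ.* (2 ℕ.* m ∸ (m ℕ.+ q)))
    ≡⟨ cong ((b ^ 2) ^ q *_) (^-*-assoc a 2 (2 ℕ.* m ∸ (m ℕ.+ q))) ⟨
  (b ^ 2) ^ q * (a ^ 2) ^ (2 ℕ.* m ∸ (m ℕ.+ q))
    ≡⟨ *-comm ((b ^ 2) ^ q) ((a ^ 2) ^ (2 ℕ.* m ∸ (m ℕ.+ q))) ⟩
  (a ^ 2) ^ (2 ℕ.* m ∸ (m ℕ.+ q)) * (b ^ 2) ^ q ∎)
  where
  open ≡-Reasoning
  q = ⌊ k /2⌋
  exponent : 2 ℕ.* m ∸ k ≡ 2 ℕ.* (2 ℕ.* m ∸ (m ℕ.+ q))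
  exponent = begin
    2 ℕ.* m ∸ k
      ≡⟨ cong (2 ℕ.* m ∸_) (trans k≡q+q (cong (q ℕ.+_) (sym (ℕ.+-identityʳ q)))) ⟩
    2 ℕ.* m ∸ 2 ℕ.* q                 ≡⟨ ℕ.*-distribˡ-∸ 2 m q ⟨
    -- `2 ℕ.* m` computes to `m ℕ.+ (m ℕ.+ 0)`, whence the added zero before the common `m` is
    -- cancelled.
    2 ℕ.* (m ∸ q)                     ≡⟨ cong (λ e → 2 ℕ.* (e ∸ q)) (ℕ.+-identityʳ m) ⟨
    2 ℕ.* (m ℕ.+ 0 ∸ q)               ≡⟨ cong (2 ℕ.*_) (ℕ.[m+n]∸[m+o]≡n∸o m (m ℕ.+ 0) q) ⟨
    2 ℕ.* (2 ℕ.* m ∸ (m ℕ.+ q))       ∎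
... | inj₂ k≡1+q+q = begin
  (1ℤ + -1ℤ ^ k) * x                  ≡⟨ cong (_* x) odd ⟩
  0ℤ * x                              ≡⟨ *-zeroˡ x ⟩
  0ℤ                                  ≡⟨ *-zeroˡ y ⟨
  0ℤ * y                              ≡⟨ cong (_* y) odd ⟨
  (1ℤ + -1ℤ ^ k) * y                  ∎
  where
  open ≡-Reasoning
  q = ⌊ k /2⌋
  x = b ^ k * a ^ (2 ℕ.* m ∸ k)
  y = (a ^ 2) ^ (2 ℕ.* m ∸ (m ℕ.+ q)) * (b ^ 2) ^ q
  odd : 1ℤ + -1ℤ ^ k ≡ 0ℤ
  odd = begin
    1ℤ + -1ℤ ^ k                      ≡⟨ cong (λ e → 1ℤ + -1ℤ ^ e) k≡1+q+q ⟩
    1ℤ + -1ℤ * -1ℤ ^ (q ℕ.+ q)        ≡⟨ cong (λ e → 1ℤ + -1ℤ * e) (trans (^-double -1ℤ q) (^-zeroˡ q)) ⟩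
    0ℤ                                ∎

-- The binomial expansions with `b` and `- b` differ by the sign (-1)^k, so their sum carries the
-- factor 1 + (-1)^k.
even-part : ∀ m a b → (a + b) ^ (2 ℕ.* m) + (a - b) ^ (2 ℕ.* m) ≡
  ∑ λ (k : Fin (suc (2 ℕ.* m))) → + (2 ℕ.* m C toℕ k) * (1ℤ + -1ℤ ^ toℕ k) *
    ((a ^ 2) ^ (2 ℕ.* m ∸ (m ℕ.+ ⌊ toℕ k /2⌋)) * (b ^ 2) ^ ⌊ toℕ k /2⌋)
even-part m a b = begin
  (a + b) ^ h + (a - b) ^ h
    ≡⟨ cong₂ (λ x y → x ^ h + y ^ h) (+-comm a b) (+-comm a (- b)) ⟩
  (b + a) ^ h + (- b + a) ^ h
    ≡⟨ cong₂ _+_ (binomial-theorem h b a) (binomial-theorem h (- b) a) ⟩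
  ∑ (term b) + ∑ (term (- b))
    ≡⟨ ∑-distrib-+ (term b) (term (- b)) ⟨
  (∑ λ k → term b k + term (- b) k)
    ≡⟨ sum-cong-≗ (λ k → trans (cong (λ x → term b k + + (h C toℕ k) * (x * a ^ (h ∸ toℕ k))) (neg-^ b (toℕ k)))
         (trans (collect (+ (h C toℕ k)) (b ^ toℕ k) (a ^ (h ∸ toℕ k)) (-1ℤ ^ toℕ k))
         (trans (cong (+ (h C toℕ k) *_) (parity-term m (toℕ k) a b))
                (sym (*-assoc (+ (h C toℕ k)) (1ℤ + -1ℤ ^ toℕ k) ((a ^ 2) ^ (h ∸ (m ℕ.+ ⌊ toℕ k /2⌋)) * (b ^ 2) ^ ⌊ toℕ k /2⌋)))))) ⟩
  (∑ λ (k : Fin (suc h)) → + (h C toℕ k) * (1ℤ + -1ℤ ^ toℕ k) *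
    ((a ^ 2) ^ (h ∸ (m ℕ.+ ⌊ toℕ k /2⌋)) * (b ^ 2) ^ ⌊ toℕ k /2⌋)) ∎
  where
  open ≡-Reasoning
  h = 2 ℕ.* m
  term : ℤ → Fin (suc h) → ℤ
  term x k = + (h C toℕ k) * (x ^ toℕ k * a ^ (h ∸ toℕ k))
  collect : ∀ c x y s → c * (x * y) + c * (s * x * y) ≡ c * ((1ℤ + s) * (x * y))
  collect = solve-∀

-- Closed forms of products and of the exponent.

∏-const : ∀ n x → (∏ λ (i : Fin n) → x) ≡ x ^ n
∏-const zero    x = refl
∏-const (suc n) x = cong (x *_) (∏-const n x)

∏-powers : ∀ n x → (∏ λ (i : Fin n) → x ^ toℕ i) ≡ x ^ triangle n
∏-powers zero    x = refl
∏-powers (suc n) x = begin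
  1ℤ * (∏ λ (i : Fin n) → x * x ^ toℕ i)
    ≡⟨ *-identityˡ (∏ λ (i : Fin n) → x * x ^ toℕ i) ⟩
  (∏ λ (i : Fin n) → x * x ^ toℕ i)
    ≡⟨ ∏-distrib-* {n} (λ _ → x) (λ i → x ^ toℕ i) ⟩
  (∏ λ (i : Fin n) → x) * (∏ λ (i : Fin n) → x ^ toℕ i)
    ≡⟨ cong₂ _*_ (∏-const n x) (∏-powers n x) ⟩
  x ^ n * x ^ triangle n
    ≡⟨ ^-distribˡ-+-* x n (triangle n) ⟨
  x ^ triangle (suc n) ∎
  where open ≡-Reasoning

∏[i<j]-square : (f : Fin n → Fin n → ℤ) → ∏[i<j] f * ∏[i<j] f ≡ ∏[i<j] (λ i j → f i j ^ 2)
∏[i<j]-square {zero}  f = refl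
∏[i<j]-square {suc n} f = begin
  ∏[i<j] f * ∏[i<j] f
    ≡⟨ cong₂ _*_ (∏[i<j]-suc f) (∏[i<j]-suc f) ⟩
  row * rest * (row * rest)
    ≡⟨ regroup row rest ⟩
  row * row * (rest * rest)
    ≡⟨ cong₂ _*_ (trans (sym (∏-distrib-* (f zero ∘ suc) (f zero ∘ suc)))
                        (∏-cong λ j → cong (f zero (suc j) *_) (sym (*-identityʳ (f zero (suc j))))))
                 (∏[i<j]-square (λ i j → f (suc i) (suc j))) ⟩
  (∏ λ j → f zero (suc j) ^ 2) * ∏[i<j] (λ i j → f (suc i) (suc j) ^ 2)
    ≡⟨ ∏[i<j]-suc (λ i j → f i j ^ 2) ⟨
  ∏[i<j] (λ i j → f i j ^ 2) ∎
  where
  open ≡-Reasoning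
  row  = ∏ λ j → f zero (suc j)
  rest = ∏[i<j] (λ i j → f (suc i) (suc j))
  regroup : ∀ x y → x * y * (x * y) ≡ x * x * (y * y)
  regroup = solve-∀

-- Stated in doubled form to avoid halving.
triangle-suc : ∀ n → triangle (suc n) ℕ.* 2 ≡ n ℕ.* suc n
triangle-suc zero    = refl
triangle-suc (suc n) = trans (ℕ.*-distribʳ-+ 2 (suc n) (triangle (suc n)))
  (trans (cong (suc n ℕ.* 2 ℕ.+_) (triangle-suc n)) (expand n))
  where
  expand : ∀ n → suc n ℕ.* 2 ℕ.+ n ℕ.* suc n ≡ suc n ℕ.* suc (suc n)
  expand = ℕ-Solver.solve-∀

triangle-odd : ∀ m → triangle (suc (2 ℕ.* m)) ≡ m ℕ.* (2 ℕ.* m ℕ.+ 1)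
triangle-odd m = ℕ.*-cancelʳ-≡ _ _ 2 (trans (triangle-suc (2 ℕ.* m)) (rearrange m))
  where
  rearrange : ∀ m → 2 ℕ.* m ℕ.* suc (2 ℕ.* m) ≡ m ℕ.* (2 ℕ.* m ℕ.+ 1) ℕ.* 2
  rearrange = ℕ-Solver.solve-∀

-- Evaluation of the determinant modulo p.

module Evaluation (p m : ℕ) (p-prime : Prime p) (p≡4m+1 : p ≡ 4 ℕ.* m ℕ.+ 1)
                  (a : Vector ℤ (suc (2 ℕ.* m))) (u v : ℤ) where

  open ≡-Reasoning

  h = 2 ℕ.* m

  p≡1+h+h : p ≡ suc (h ℕ.+ h)
  p≡1+h+h = trans p≡4m+1 (rearrange m)
    where
    rearrange : ∀ m → 4 ℕ.* m ℕ.+ 1 ≡ suc (2 ℕ.* m ℕ.+ 2 ℕ.* m)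
    rearrange = ℕ-Solver.solve-∀

  0<m : 0 ℕ.< m
  0<m = go m p≡4m+1
    where
    go : ∀ m → p ≡ 4 ℕ.* m ℕ.+ 1 → 0 ℕ.< m
    go zero    refl = contradiction p-prime ¬prime[1]
    go (suc m) _    = z<s

  open Congruence p
  open Field p-prime
  open Euler h p≡1+h+h

  -- Powers of the squares, descending in `w` and ascending in `z`. The exponent in `w` is
  -- `h ∸ toℕ r`, written in the form that `det-reverseVandermonde` expects.
  w z : Matrix (suc h)
  w i r = (a i ^ 2) ^ (suc h ∸ suc (toℕ r))
  z s j = (a j ^ 2) ^ toℕ s

  α β : Vector ℤ (suc h)
  α s = u * (+ (h C toℕ s) * v ^ toℕ s)
  β k = + (h C toℕ k) * (1ℤ + -1ℤ ^ toℕ k)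

  half≤m : ∀ (k : Fin (suc h)) → ⌊ toℕ k /2⌋ ℕ.≤ m
  half≤m k = subst (⌊ toℕ k /2⌋ ℕ.≤_)
    (trans (cong (λ e → ⌊ m ℕ.+ e /2⌋) (ℕ.+-identityʳ m)) (sym (ℕ.n≡⌊n+n/2⌋ m)))
    (ℕ.⌊n/2⌋-mono (ℕ.s≤s⁻¹ (toℕ<n k)))

  ρ-bound : ∀ (k : Fin (suc h)) → m ℕ.+ ⌊ toℕ k /2⌋ ℕ.< suc h
  ρ-bound k = s≤s (subst (λ e → m ℕ.+ ⌊ toℕ k /2⌋ ℕ.≤ m ℕ.+ e) (sym (ℕ.+-identityʳ m)) (ℕ.+-monoʳ-≤ m (half≤m k)))

  σ-bound : ∀ (k : Fin (suc h)) → ⌊ toℕ k /2⌋ ℕ.< suc h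
  σ-bound k = ℕ.≤-<-trans (ℕ.m≤n+m ⌊ toℕ k /2⌋ m) (ρ-bound k)

  -- Row and column of the k-th term of the even part in the coefficient matrix: the exponents m -
  -- ⌊k/2⌋ and ⌊k/2⌋ correspond to the indices m + ⌊k/2⌋ and ⌊k/2⌋.
  ρ σ : Fin (suc h) → Fin (suc h)
  ρ k = fromℕ< (ρ-bound k)
  σ k = fromℕ< (σ-bound k)

  -- The two indices differ by `m`, which is positive because 1 is not prime.
  σ<ρ : ∀ k → σ k < ρ k
  σ<ρ k rewrite toℕ-fromℕ< (ρ-bound k) | toℕ-fromℕ< (σ-bound k) = ℕ.m<n+m ⌊ toℕ k /2⌋ 0<m

  P : ℤ
  P = ∏[i<j] (λ (i j : Fin (suc h)) → a j ^ 2 - a i ^ 2)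

  binomial-part : ∀ i j → u * (a i ^ 2 + v * a j ^ 2) ^ h ≡ ∑ λ s → α s * (w i s * z s j)
  binomial-part i j = begin
    u * (x + v * y) ^ h
      ≡⟨ cong (λ e → u * e ^ h) (+-comm x (v * y)) ⟩
    u * (v * y + x) ^ h
      ≡⟨ cong (u *_) (binomial-theorem h (v * y) x) ⟩
    u * (∑ λ (s : Fin (suc h)) → + (h C toℕ s) * ((v * y) ^ toℕ s * x ^ (h ∸ toℕ s)))
      ≡⟨ *-distribˡ-sum {suc h} u (λ s → + (h C toℕ s) * ((v * y) ^ toℕ s * x ^ (h ∸ toℕ s))) ⟩
    (∑ λ (s : Fin (suc h)) → u * (+ (h C toℕ s) * ((v * y) ^ toℕ s * x ^ (h ∸ toℕ s))))
      ≡⟨ sum-cong-≗ {suc h} (λ s → trans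
           (cong (λ e → u * (+ (h C toℕ s) * (e * x ^ (h ∸ toℕ s)))) (^-distrib-* v y (toℕ s)))
           (rearrange u (+ (h C toℕ s)) (v ^ toℕ s) (y ^ toℕ s) (x ^ (h ∸ toℕ s)))) ⟩
    (∑ λ s → α s * (w i s * z s j)) ∎
    where
    x = a i ^ 2
    y = a j ^ 2
    ^-distrib-* : ∀ x y n → (x * y) ^ n ≡ x ^ n * y ^ n
    ^-distrib-* x y zero    = refl
    ^-distrib-* x y (suc n) = trans (cong (x * y *_) (^-distrib-* x y n)) (swap-factors x y (x ^ n) (y ^ n))
      where
      swap-factors : ∀ x y a b → x * y * (a * b) ≡ x * a * (y * b)
      swap-factors = solve-∀
    rearrange : ∀ u c v y x → u * (c * (v * y * x)) ≡ u * (c * v) * (x * y)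
    rearrange = solve-∀

  even-part-entry : ∀ i j → (a i + a j) ^ h + (a i - a j) ^ h ≡ ∑ λ k → β k * (w i (ρ k) * z (σ k) j)
  even-part-entry i j = trans (even-part m (a i) (a j)) (sum-cong-≗ {suc h} λ k → sym
    (cong₂ (λ r s → β k * ((a i ^ 2) ^ (h ∸ r) * (a j ^ 2) ^ s)) (toℕ-fromℕ< (ρ-bound k)) (toℕ-fromℕ< (σ-bound k))))

  entry : ∀ i j → χ p (a i + a j) + χ p (a i - a j) + u * χ p (a i ^ 2 + v * a j ^ 2) ≈
                  (∑ λ s → α s * (w i s * z s j)) + (∑ λ k → β k * (w i (ρ k) * z (σ k) j))
  entry i j = ≈-trans
    (+-cong (+-cong (euler-criterion (a i + a j)) (euler-criterion (a i - a j)))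
            (*-cong (≈-refl {u}) (euler-criterion (a i ^ 2 + v * a j ^ 2))))
    (≈-reflexive (trans (cong₂ _+_ (even-part-entry i j) (binomial-part i j))
      (+-comm (∑ λ k → β k * (w i (ρ k) * z (σ k) j)) (∑ λ s → α s * (w i s * z s j)))))

  ∏α : ∏ α ≡ u ^ suc h * ((∏ λ (r : Fin (suc h)) → + (h C toℕ r)) * v ^ triangle (suc h))
  ∏α = begin
    ∏ α
      ≡⟨ ∏-distrib-* {suc h} (λ _ → u) (λ s → + (h C toℕ s) * v ^ toℕ s) ⟩
    (∏ λ (s : Fin (suc h)) → u) * (∏ λ (s : Fin (suc h)) → + (h C toℕ s) * v ^ toℕ s)
      ≡⟨ cong₂ _*_ (∏-const (suc h) u) (trans (∏-distrib-* {suc h} (λ s → + (h C toℕ s)) (λ s → v ^ toℕ s))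
           (cong ((∏ λ (r : Fin (suc h)) → + (h C toℕ r)) *_) (∏-powers (suc h) v))) ⟩
    u ^ suc h * ((∏ λ (r : Fin (suc h)) → + (h C toℕ r)) * v ^ triangle (suc h)) ∎

  -- The determinants of `w` and `z` are the same Vandermonde product up to the sign of the
  -- reversal, so together they give its square.
  evaluation : det w * ∏ α * det z ≡
    -1ℤ ^ (m ℕ.* (2 ℕ.* m ℕ.+ 1)) * u ^ (2 ℕ.* m ℕ.+ 1) * v ^ (m ℕ.* (2 ℕ.* m ℕ.+ 1))
      * (∏ λ (r : Fin (suc h)) → + (h C toℕ r)) * ∏[i<j] (λ (i j : Fin (suc h)) → (a j ^ 2 - a i ^ 2) ^ 2)
  evaluation = begin
    det w * ∏ α * det z
      ≡⟨ cong₂ _*_ (cong₂ _*_ (det-reverseVandermonde (λ i → a i ^ 2)) ∏α) (det-vandermonde (λ i → a i ^ 2)) ⟩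
    -1ℤ ^ t * P * (u ^ suc h * (B * v ^ t)) * P
      ≡⟨ regroup (-1ℤ ^ t) P (u ^ suc h) B (v ^ t) ⟩
    -1ℤ ^ t * u ^ suc h * v ^ t * B * (P * P)
      ≡⟨ cong (-1ℤ ^ t * u ^ suc h * v ^ t * B *_) (∏[i<j]-square (λ i j → a j ^ 2 - a i ^ 2)) ⟩
    -1ℤ ^ t * u ^ suc h * v ^ t * B * Q
      ≡⟨ cong₂ (λ e f → -1ℤ ^ e * u ^ f * v ^ e * B * Q) (triangle-odd m) (ℕ.+-comm 1 h) ⟩
    -1ℤ ^ (m ℕ.* (h ℕ.+ 1)) * u ^ (h ℕ.+ 1) * v ^ (m ℕ.* (h ℕ.+ 1)) * B * Q ∎
    where
    t = triangle (suc h)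
    B = ∏ λ (r : Fin (suc h)) → + (h C toℕ r)
    Q = ∏[i<j] (λ (i j : Fin (suc h)) → (a j ^ 2 - a i ^ 2) ^ 2)
    regroup : ∀ s p u b v → s * p * (u * (b * v)) * p ≡ s * u * v * b * (p * p)
    regroup = solve-∀

  result : D p a u v ≈
    -1ℤ ^ (m ℕ.* (2 ℕ.* m ℕ.+ 1)) * u ^ (2 ℕ.* m ℕ.+ 1) * v ^ (m ℕ.* (2 ℕ.* m ℕ.+ 1))
      * (∏ λ (r : Fin (suc h)) → + (h C toℕ r)) * ∏[i<j] (λ (i j : Fin (suc h)) → (a j ^ 2 - a i ^ 2) ^ 2)
  result = ≈-trans (det-cong-≈ entry)
    (≈-reflexive (trans (det-bilinear w z α β ρ σ σ<ρ) evaluation))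

theorem1p2 : (p m : ℕ) → Prime p → p ≡ 4 ℕ.* m ℕ.+ 1 →
    (a : Vector ℤ (suc (2 ℕ.* m))) →
    (∀ i j → i < j → ¬ (a i ^ 2 ≡ a j ^ 2 [mod p ])) →
    (u v : ℤ) →
    D p a u v
    ≡ -1ℤ ^ (m ℕ.* (2 ℕ.* m ℕ.+ 1))
    * u ^ (2 ℕ.* m ℕ.+ 1)
    * v ^ (m ℕ.* (2 ℕ.* m ℕ.+ 1))
    * ∏ (λ (r : Fin (suc (2 ℕ.* m))) → + ((2 ℕ.* m) C toℕ r))
    * ∏[i<j] (λ (i j : Fin (suc (2 ℕ.* m))) → (a j ^ 2 - a i ^ 2) ^ 2)
    [mod p ]
theorem1p2 p m p-prime p≡4m+1 a _ u v = Congruence.congruence (Evaluation.result p m p-prime p≡4m+1 a u v)
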